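{- Let $n\geq 5$ and let $G$ be a connected graph on $n$ vertices with no pendant vertex. Then $F(G)\geq F(C_n)$ if $n\leq 16$, and $F(G)\geq F(C_{3,3}^n)$ if $n>16$. Moreover, $$F(G)\geq \min\left\{n^2+1,\ \frac{n^2+17n}{2}\right\}.$$
   Context: All graphs are finite, simple and undirected. A pendant vertex is a vertex of degree one. $C_m$ is the cycle on $m$ vertices. For $n\geq 5$, $C_{3,3}^n$ is the graph on $n$ vertices obtained as follows: if $n\geq 6$, take a path on $n-4$ vertices and identify one end vertex of the path with a vertex of a triangle $C_3$ and the other end vertex with a vertex of a second (disjoint) triangle $C_3$; if $n=5$, it is two triangles sharing exactly one vertex. A connected subgraph of a graph $G=(V,E)$ is a graph $(V',E')$ with $\emptyset\neq V'\subseteq V$, $E'\subseteq E$, every edge of $E'$ having both endpoints in $V'$, and $(V',E')$ connected; distinct pairs $(V',E')$ are counted separately. The core index $F(G)$ is the number of connected subgraphs of $G$. -}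

module Defs where

open import Data.Bool using (Bool; true; false; T; _∧_; _∨_)
open import Data.Nat using (ℕ; zero; suc; _+_; _∸_; _≤ᵇ_; _≡ᵇ_)
open import Data.Fin using (Fin; toℕ)
open import Data.Fin.Subset using (Subset; _∈_; Nonempty)
open import Data.List using (List; length; filterᵇ; allFin)
open import Data.List.Relation.Unary.Unique.Propositional using (Unique)
import Data.List.Membership.Propositional as LM
open import Data.Vec using (Vec; lookup)
open import Data.Product using (Σ; _×_; _,_)
open import Relation.Binary.PropositionalEquality using (_≡_; _≢_)

Graph : ℕ → Set
Graph n = Fin n → Fin n → Bool

record IsSimple {n : ℕ} (G : Graph n) : Set where
  field
    sym     : ∀ u v → G u v ≡ G v u
    irrefl  : ∀ u → G u u ≡ false

data Walk {n : ℕ} (R : Graph n) : Fin n → Fin n → Set where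
  here : ∀ {u} → Walk R u u
  step : ∀ {u v w} → T (R u v) → Walk R v w → Walk R u w

Connected : ∀ {n} → Graph n → Set
Connected {n} G = ∀ (u v : Fin n) → Walk G u v

degree : ∀ {n} → Graph n → Fin n → ℕ
degree {n} G u = length (filterᵇ (G u) (allFin n))

NoPendant : ∀ {n} → Graph n → Set
NoPendant {n} G = ∀ (u : Fin n) → degree G u ≢ 1

-- Edge subsets are represented by symmetric Boolean adjacency matrices.
EdgeSet : ℕ → Set
EdgeSet n = Vec (Vec Bool n) n

edgeRel : ∀ {n} → EdgeSet n → Graph n
edgeRel E u v = lookup (lookup E u) v

record IsConnSub {n : ℕ} (G : Graph n) (V : Subset n) (E : EdgeSet n) : Set where
  field
    nonempty   : Nonempty V
    symmetric  : ∀ u v → edgeRel E u v ≡ edgeRel E v u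
    subEdges   : ∀ u v → T (edgeRel E u v) → T (G u v)
    endpoints  : ∀ u v → T (edgeRel E u v) → (u ∈ V) × (v ∈ V)
    connected  : ∀ u v → u ∈ V → v ∈ V → Walk (edgeRel E) u v

-- CoreIndex G k : F(G) = k, i.e. there is a duplicate-free list of length k
-- containing exactly the connected subgraphs (V', E') of G.
CoreIndex : ∀ {n} → Graph n → ℕ → Set
CoreIndex {n} G k =
  Σ (List (Subset n × EdgeSet n)) λ L →
    (length L ≡ k) × Unique L ×
    (∀ V E → (V , E) LM.∈ L → IsConnSub G V E) ×
    (∀ V E → IsConnSub G V E → (V , E) LM.∈ L)

cycleℕ : ℕ → ℕ → ℕ → Bool
cycleℕ n a b = (suc a ≡ᵇ b) ∨ ((suc a ≡ᵇ n) ∧ (b ≡ᵇ 0))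

Cycle : (n : ℕ) → Graph n
Cycle n u v = cycleℕ n (toℕ u) (toℕ v) ∨ cycleℕ n (toℕ v) (toℕ u)

-- C_{3,3}^n (n ≥ 5): triangle {0,1,2}; path 2 – 3 – … – (n-3) on n-4 vertices;
-- triangle {n-3, n-2, n-1}.  For n = 5 this is two triangles sharing vertex 2.
c33ℕ : ℕ → ℕ → ℕ → Bool
c33ℕ n a b =
     ((a ≡ᵇ 0) ∧ (b ≡ᵇ 1)) ∨ ((a ≡ᵇ 0) ∧ (b ≡ᵇ 2)) ∨ ((a ≡ᵇ 1) ∧ (b ≡ᵇ 2))
  ∨ ((2 ≤ᵇ a) ∧ (b ≡ᵇ suc a) ∧ (b ≤ᵇ n ∸ 3))
  ∨ ((a ≡ᵇ n ∸ 3) ∧ (b ≡ᵇ n ∸ 2)) ∨ ((a ≡ᵇ n ∸ 3) ∧ (b ≡ᵇ n ∸ 1))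
  ∨ ((a ≡ᵇ n ∸ 2) ∧ (b ≡ᵇ n ∸ 1))

C33 : (n : ℕ) → Graph n
C33 n u v = c33ℕ n (toℕ u) (toℕ v) ∨ c33ℕ n (toℕ v) (toℕ u)

{-# OPTIONS --safe #-}
module Submission where

-- Write tri n = n (n + 1) / 2, so that (n² + 17 n) / 2 = tri n + 8 n.
--
-- Lower bound.  Call a connected vertex set A dense with surplus d if every
-- vertex of A lies on at least |A| + d connected subgraphs inside A.  Gluing
-- two such sets at a single common vertex adds the surpluses, because unions
-- of subgraphs through the common vertex can be taken apart again.  A pendant
-- edge has surplus 0 and a cycle of length c has surplus 1 + tri (c - 1), so a
-- cycle can be grown to the whole graph by pendant edges.  A cycle of length
-- at least 5 already gives n² + 1 or tri n + 8 n this way.  From a triangle or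
-- a 4-cycle, a path that never turns back ends in a second cycle, which is
-- glued on, or closes an ear; an ear gives a longer cycle, or K₂,₃.
--
-- Upper bounds.  A proper connected subgraph of the cycle is an arc, given by
-- its start and its length.  In C33 the path vertices are peeled off one at a
-- time, and each end triangle offers 7 patterns at its attaching vertex.

open import Defs
open import Data.Bool using (Bool; true; false; T; _∧_; if_then_else_)
open import Data.Bool.Properties using (T?; T-≡; T-∨; T-∧)
open import Data.Empty using (⊥; ⊥-elim)
open import Data.Fin using (Fin; zero; suc; toℕ; fromℕ; fromℕ<; inject₁; splitAt; join; _↑ˡ_; _↑ʳ_; combine; remQuot; punchIn)
open import Data.Fin.Induction using (<-weakInduction; >-weakInduction)
open import Data.Fin.Properties using (_≟_; any?; all?; injective⇒≤; join-splitAt; splitAt-↑ˡ; splitAt-↑ʳ; combine-remQuot; remQuot-combine; punchIn-injective; punchInᵢ≢i; toℕ<n; toℕ-fromℕ; toℕ-fromℕ<; toℕ-injective; toℕ-inject; toℕ-inject₁; fromℕ≢inject₁; inject₁-injective; pigeonhole; ¬∀⟶∃¬-smallest)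
import Data.Fin.Subset as Subset
open import Data.List using (List; []; _∷_; length; _++_; lookup; allFin)
open import Data.List.Membership.DecPropositional using () renaming (_∈?_ to member?)
open import Data.List.Membership.Propositional using (_∈_; _∉_)
open import Data.List.Membership.Propositional.Properties using (∈-++⁺ˡ; ∈-++⁺ʳ; ∈-++⁻; ∈-∃++; ∈-filter⁺; ∈-filter⁻; ∈-allFin; ∈-lookup)
open import Data.List.Properties using (length-++)
open import Data.List.Relation.Binary.Permutation.Propositional using (_↭_; ↭-sym; ↭-refl; ↭⇒↭ₛ)
open import Data.List.Relation.Binary.Permutation.Propositional.Properties using (∈-resp-↭; ++-comm; ↭-length)
import Data.List.Relation.Binary.Permutation.Setoid.Properties as PermSetoid
open import Data.List.Relation.Unary.All as All using ([]; _∷_)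
import Data.List.Relation.Unary.All.Properties as AllP
open import Data.List.Relation.Unary.AllPairs using ([]; _∷_)
open import Data.List.Relation.Unary.Any using (here; there; index)
open import Data.List.Relation.Unary.Any.Properties using (lookup-index)
open import Data.List.Relation.Unary.Unique.Propositional using (Unique)
import Data.List.Relation.Unary.Unique.Propositional.Properties as Uniq
open import Data.Nat as ℕ using (ℕ; zero; suc; _+_; _*_; _≤_; _<_; _⊓_; z≤n; s≤s; _≤?_)
open import Data.Nat.DivMod using (_/_; m*n/n≡m)
open import Data.Nat.Properties using (+-suc; +-comm; +-identityʳ; *-identityʳ; *-distribʳ-+; suc-injective; ≤-refl; ≤-reflexive; ≤-trans; ≤-antisym; ≤-total; ≤-pred; ≤∧≢⇒<; <⇒≤; <⇒≱; ≰⇒>; n≮n; n≤1+n; m≤m+n; m≤n+m; m≤n⇒m<n∨m≡n; m≤n⇒∃[o]m+o≡n; +-mono-≤; +-monoˡ-≤; +-monoʳ-≤; *-mono-≤; *-monoˡ-≤; *-monoʳ-≤; +-cancelʳ-≤; *-cancelˡ-≤; m⊓n≤m; m⊓n≤n; ≡ᵇ⇒≡; ≤ᵇ⇒≤; module ≤-Reasoning)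
open import Data.Nat.Tactic.RingSolver using (solve-∀)
open import Data.Product using (Σ; ∃; _×_; _,_; proj₁; proj₂)
open import Data.Sum using (_⊎_; inj₁; inj₂; [_,_]′)
open import Data.Unit using (⊤; tt)
open import Data.Vec as Vec using (Vec; tabulate)
open import Data.Vec.Properties using ([]=⇒lookup; lookup⇒[]=; lookup∘tabulate; tabulate∘lookup; tabulate-cong)
open import Function using (Equivalence)
open import Relation.Binary.Construct.Closure.ReflexiveTransitive using (Star; ε; _◅_; _◅◅_; map; reverse)
open import Relation.Binary.PropositionalEquality using (_≡_; _≢_; refl; sym; trans; cong; cong₂; subst; setoid; ≢-sym)
open import Relation.Nullary using (Dec; yes; no; ¬_; does)
open import Relation.Nullary.Decidable using (¬?; toWitness; fromWitness; _×-dec_; _⊎-dec_; _→-dec_; ⌊_⌋)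

-- The two bounds are values of F: `n * n + 1` belongs to the cycle, `tri n + 8 * n` to two
-- triangles joined by a path. The coefficient 8 is 4 + 4, because a triangle has surplus 4. The
-- obstacle is that one triangle (surplus 4) or one 4-cycle (surplus 7) stays below 8, so the
-- absence of pendant vertices has to supply a second cycle. A longer cycle suffices alone, with no
-- slack against `n * n + 1` when it passes through every vertex. K₂,₃ escapes both arguments: it
-- has no cycle longer than 4, and its cycles share more than one vertex. It is counted by hand. No
-- value of F is computed exactly. Lower bounds only need pairwise different subgraphs, upper bounds
-- only need lists that miss none. For every n ≥ 5 it is shown that F(G) reaches one of the two
-- bounds; which of them is smaller matters only at the end, where n² - 17n + 2 changes sign between
-- 16 and 17.

record Sub (n : ℕ) : Set₁ where
  field
    V  : Fin n → Set
    E  : Fin n → Fin n → Set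
    V? : ∀ v → Dec (V v)
    E? : ∀ u v → Dec (E u v)

open Sub public

-- Subgraphs up to equality, and families of distinct subgraphs.

module _ {n : ℕ} where

  infix 4 _≲_ _≈_
  infixr 6 _∪_

  _≲_ : Sub n → Sub n → Set
  H ≲ K = (∀ {v} → V H v → V K v) × (∀ {u v} → E H u v → E K u v)

  -- Subgraphs are decidable predicates, which makes unions and restrictions immediate; equality
  -- then has to be extensional, and all counts are up to this relation.
  _≈_ : Sub n → Sub n → Set
  H ≈ K = H ≲ K × K ≲ H

  ≲-trans : ∀ {H K L} → H ≲ K → K ≲ L → H ≲ L
  ≲-trans (f , g) (f′ , g′) = (λ x → f′ (f x)) , (λ x → g′ (g x))

  ≈-sym : ∀ {H K} → H ≈ K → K ≈ H
  ≈-sym (p , q) = q , p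

  ≈-trans : ∀ {H K L} → H ≈ K → K ≈ L → H ≈ L
  ≈-trans {H} {K} {L} (p , q) (p′ , q′) = ≲-trans {H} {K} {L} p p′ , ≲-trans {L} {K} {H} q′ q

  pt : Fin n → Sub n
  pt v = record
    { V = λ x → x ≡ v ; E = λ _ _ → ⊥ ; V? = λ x → x ≟ v ; E? = λ _ _ → no λ () }

  ed : Fin n → Fin n → Sub n
  ed u v = record
    { V  = λ x → (x ≡ u) ⊎ (x ≡ v)
    ; E  = λ x y → (x ≡ u × y ≡ v) ⊎ (x ≡ v × y ≡ u)
    ; V? = λ x → (x ≟ u) ⊎-dec (x ≟ v)
    ; E? = λ x y → ((x ≟ u) ×-dec (y ≟ v)) ⊎-dec ((x ≟ v) ×-dec (y ≟ u)) }

  _∪_ : Sub n → Sub n → Sub n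
  H ∪ K = record
    { V  = λ x → V H x ⊎ V K x
    ; E  = λ x y → E H x y ⊎ E K x y
    ; V? = λ x → V? H x ⊎-dec V? K x
    ; E? = λ x y → E? H x y ⊎-dec E? K x y }

  -- Witnesses a lower bound: at least `m` subgraphs satisfy `P`, up to `_≈_`.
  record Fam (P : Sub n → Set) (m : ℕ) : Set₁ where
    constructor fam
    field
      at  : Fin m → Sub n
      ok  : ∀ i → P (at i)
      inj : ∀ {i j} → at i ≈ at j → i ≡ j

  open Fam public

  Fam-⊆ : ∀ {P Q m} → (∀ {H} → P H → Q H) → Fam P m → Fam Q m
  Fam-⊆ f F = fam (at F) (λ i → f (ok F i)) (inj F)

  Fam-cast : ∀ {P m k} → m ≡ k → Fam P m → Fam P k
  Fam-cast {P} = subst (Fam P)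

  Fam-one : ∀ {P} H → P H → Fam P 1
  Fam-one H p = fam (λ _ → H) (λ _ → p) (λ { {zero} {zero} _ → refl })

  Fam-map : ∀ {P Q m} (f : Sub n → Sub n) → (∀ {H} → P H → Q (f H)) →
    (∀ {H K} → P H → P K → f H ≈ f K → H ≈ K) → Fam P m → Fam Q m
  Fam-map f q i F = fam (λ j → f (at F j)) (λ j → q (ok F j))
    (λ eq → inj F (i (ok F _) (ok F _) eq))

  Fam-⊎ : ∀ {P Q R m k} → (∀ {H} → P H → R H) → (∀ {H} → Q H → R H) →
    (∀ {H K} → P H → Q K → ¬ (H ≈ K)) → Fam P m → Fam Q k → Fam R (m + k)
  Fam-⊎ {P} {Q} {R} {m} {k} p q dis F F′ =
    fam (λ i → pick (splitAt m i)) (λ i → pick-ok (splitAt m i))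
      (λ {i} {j} eq → trans (sym (join-splitAt m k i))
        (trans (cong (join m k) (pick-inj (splitAt m i) (splitAt m j) eq)) (join-splitAt m k j)))
    where
    pick : Fin m ⊎ Fin k → Sub n
    pick (inj₁ i) = at F i
    pick (inj₂ j) = at F′ j
    pick-ok : ∀ s → R (pick s)
    pick-ok (inj₁ i) = p (ok F i)
    pick-ok (inj₂ j) = q (ok F′ j)
    pick-inj : ∀ s t → pick s ≈ pick t → s ≡ t
    pick-inj (inj₁ _) (inj₁ _) eq = cong inj₁ (inj F eq)
    pick-inj (inj₂ _) (inj₂ _) eq = cong inj₂ (inj F′ eq)
    pick-inj (inj₁ i) (inj₂ j) eq = ⊥-elim (dis (ok F i) (ok F′ j) eq)
    pick-inj (inj₂ j) (inj₁ i) eq =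
      ⊥-elim (dis (ok F i) (ok F′ j) (≈-sym {at F′ j} {at F i} eq))

  Fam-× : ∀ {P Q R m k} (f : Sub n → Sub n → Sub n) →
    (∀ {H K} → P H → Q K → R (f H K)) →
    (∀ {H K H′ K′} → P H → Q K → P H′ → Q K′ → f H K ≈ f H′ K′ → H ≈ H′ × K ≈ K′) →
    Fam P m → Fam Q k → Fam R (m * k)
  Fam-× {m = m} {k} f r i F F′ =
    fam (λ j → f (at F (proj₁ (remQuot {m} k j))) (at F′ (proj₂ (remQuot {m} k j))))
      (λ j → r (ok F _) (ok F′ _))
      (λ {a} {b} eq →
        let (x , y) = i (ok F _) (ok F′ _) (ok F _) (ok F′ _) eq in
        trans (sym (combine-remQuot {m} k a))
          (trans (cong₂′ (inj F x) (inj F′ y)) (combine-remQuot {m} k b)))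
    where
    cong₂′ : ∀ {a a′ : Fin m} {b b′ : Fin k} → a ≡ a′ → b ≡ b′ → combine a b ≡ combine a′ b′
    cong₂′ refl refl = refl

  -- At most one member can fail `Q`, since any two failures are equal. If none fails, an arbitrary
  -- member is given up so that the size is the same in both cases.
  Fam-drop : ∀ {P Q : Sub n → Set} {m} → (∀ {H} → P H → Dec (Q H)) →
    (∀ {H K} → P H → P K → ¬ Q H → ¬ Q K → H ≈ K) →
    Fam P (suc m) → Fam (λ H → P H × Q H) m
  Fam-drop {P} {Q} {m} Q? same F with any? (λ i → ¬? (Q? (ok F i)))
  ... | no none = fam (λ i → at F (suc i))
          (λ i → ok F (suc i) , keep (suc i))
          (λ eq → suc-inj (inj F eq))
    where
    suc-inj : ∀ {i j : Fin m} → Fin.suc i ≡ suc j → i ≡ j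
    suc-inj refl = refl
    keep : ∀ i → Q (at F i)
    keep i with Q? (ok F i)
    ... | yes q = q
    ... | no ¬q = ⊥-elim (none (i , ¬q))
  ... | yes (b , ¬qb) = fam (λ i → at F (punchIn b i))
          (λ i → ok F (punchIn b i) , keep i)
          (λ eq → punchIn-injective b _ _ (inj F eq))
    where
    keep : ∀ i → Q (at F (punchIn b i))
    keep i with Q? (ok F (punchIn b i))
    ... | yes q = q
    ... | no ¬q = ⊥-elim (punchInᵢ≢i b i (inj F (same (ok F _) (ok F b) ¬q ¬qb)))

module _ {n : ℕ} (G : Graph n) where

  record Conn (H : Sub n) : Set where
    field
      ne   : ∃ (V H)
      symm : ∀ {u v} → E H u v → E H v u
      adj  : ∀ {u v} → E H u v → T (G u v)
      end  : ∀ {u v} → E H u v → V H u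
      conn : ∀ {u v} → V H u → V H v → Star (E H) u v

  open Conn public

-- Gluing dense vertex sets at a common vertex.

module Growth {n : ℕ} {G : Graph n} (simple : IsSimple G) where

  adj-sym : ∀ {u v} → T (G u v) → T (G v u)
  adj-sym {u} {v} = subst T (IsSimple.sym simple u v)

  adj-irrefl : ∀ {u v} → T (G u v) → u ≢ v
  adj-irrefl {u} p refl = subst T (IsSimple.irrefl simple u) p

  pt-conn : ∀ v → Conn G (pt v)
  pt-conn v = record { ne = v , refl ; symm = λ () ; adj = λ () ; end = λ ()
                     ; conn = λ { refl refl → ε } }

  ed-conn : ∀ {u v} → T (G u v) → Conn G (ed u v)
  ed-conn {u} {v} a = record
    { ne   = u , inj₁ refl
    ; symm = λ { (inj₁ (p , q)) → inj₂ (q , p) ; (inj₂ (p , q)) → inj₁ (q , p) }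
    ; adj  = λ { (inj₁ (refl , refl)) → a ; (inj₂ (refl , refl)) → adj-sym a }
    ; end  = λ { (inj₁ (p , _)) → inj₁ p ; (inj₂ (p , _)) → inj₂ p }
    ; conn = λ { (inj₁ refl) (inj₁ refl) → ε ; (inj₂ refl) (inj₂ refl) → ε
               ; (inj₁ refl) (inj₂ refl) → inj₁ (refl , refl) ◅ ε
               ; (inj₂ refl) (inj₁ refl) → inj₂ (refl , refl) ◅ ε } }

  ∪-conn : ∀ {H K w} → Conn G H → Conn G K → V H w → V K w → Conn G (H ∪ K)
  ∪-conn {H} {K} {w} c d hw kw = record
    { ne   = w , inj₁ hw
    ; symm = λ { (inj₁ e) → inj₁ (symm c e) ; (inj₂ e) → inj₂ (symm d e) }
    ; adj  = λ { (inj₁ e) → adj c e ; (inj₂ e) → adj d e }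
    ; end  = λ { (inj₁ e) → inj₁ (end c e) ; (inj₂ e) → inj₂ (end d e) }
    ; conn = λ p q → to p ◅◅ from q }
    where
    to : ∀ {u} → V H u ⊎ V K u → Star (E (H ∪ K)) u w
    to (inj₁ p) = map inj₁ (conn c p hw)
    to (inj₂ p) = map inj₂ (conn d p kw)
    from : ∀ {u} → V H u ⊎ V K u → Star (E (H ∪ K)) w u
    from (inj₁ p) = map inj₁ (conn c hw p)
    from (inj₂ p) = map inj₂ (conn d kw p)

  In : List (Fin n) → Sub n → Set
  In A H = ∀ {v} → V H v → v ∈ A

  ∪-in : ∀ {A H K} → In A H → In A K → In A (H ∪ K)
  ∪-in p q (inj₁ x) = p x
  ∪-in p q (inj₂ x) = q x

  Inner : List (Fin n) → Sub n → Set
  Inner A H = Conn G H × In A H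

  Rooted : List (Fin n) → Fin n → Sub n → Set
  Rooted A z H = Inner A H × V H z

  -- A vertex that `K` shares with `H` must be `y`, which already lies in `K′`; a shared edge would
  -- be a loop at `y`.
  recover : ∀ {A B y H K K′} → (∀ {v} → v ∈ A → v ∈ B → v ≡ y) →
    Inner A H → Inner B K → V K′ y → K ≲ H ∪ K′ → K ≲ K′
  recover {A} {B} {y} {H} {K} {K′} only (ch , ih) (ck , ik) k′y (f , g) = fv , fe
    where
    fv : ∀ {v} → V K v → V K′ v
    fv kv with f kv
    ... | inj₂ k′v = k′v
    ... | inj₁ hv with refl ← only (ih hv) (ik kv) = k′y
    fe : ∀ {u v} → E K u v → E K′ u v
    fe ke with g ke
    ... | inj₂ k′e = k′e
    ... | inj₁ he = ⊥-elim (adj-irrefl (adj ck ke)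
            (trans (only (ih (end ch he)) (ik (end ck ke)))
              (sym (only (ih (end ch (symm ch he))) (ik (end ck (symm ck ke)))))))

  ∪-comm-≲ : ∀ {H K L : Sub n} → L ≲ H ∪ K → L ≲ K ∪ H
  ∪-comm-≲ (f , g) = (λ x → [ inj₂ , inj₁ ]′ (f x)) , (λ x → [ inj₂ , inj₁ ]′ (g x))

  ∪-left : ∀ {H K L : Sub n} → H ∪ K ≲ L → H ≲ L
  ∪-left (f , g) = (λ x → f (inj₁ x)) , (λ x → g (inj₁ x))

  ∪-right : ∀ {H K L : Sub n} → H ∪ K ≲ L → K ≲ L
  ∪-right (f , g) = (λ x → f (inj₂ x)) , (λ x → g (inj₂ x))

  module _ {A B : List (Fin n)} {y : Fin n} (only : ∀ {v} → v ∈ A → v ∈ B → v ≡ y) where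

    ∪-injʳ : ∀ {H K H′ K′} → Rooted A y H → Rooted B y K → Rooted A y H′ → Rooted B y K′ →
      H ∪ K ≈ H′ ∪ K′ → K ≈ K′
    ∪-injʳ {H} {K} {H′} {K′} (h , _) (k , ky) (h′ , _) (k′ , k′y) (p , q) =
      recover {H = H′} {K} {K′} only h′ k k′y (∪-right {H} {K} {H′ ∪ K′} p) ,
      recover {H = H} {K′} {K} only h k′ ky (∪-right {H′} {K′} {H ∪ K} q)

  ∪-inj : ∀ {A B y} (only : ∀ {v} → v ∈ A → v ∈ B → v ≡ y) → ∀ {H K H′ K′} →
    Rooted A y H → Rooted B y K → Rooted A y H′ → Rooted B y K′ →
    H ∪ K ≈ H′ ∪ K′ → H ≈ H′ × K ≈ K′
  ∪-inj only {H} {K} {H′} {K′} h k h′ k′ (p , q) =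
    ∪-injʳ (λ b a → only a b) {K} {H} {K′} {H′} k h k′ h′
      (flip≲ {H} {K} {H′} {K′} p , flip≲ {H′} {K′} {H} {K} q) ,
    ∪-injʳ only {H} {K} {H′} {K′} h k h′ k′ (p , q)
    where
    flip≲ : ∀ {H K H′ K′ : Sub n} → H ∪ K ≲ H′ ∪ K′ → K ∪ H ≲ K′ ∪ H′
    flip≲ (f , g) = (λ x → swap (f (swap x))) , (λ x → swap (g (swap x)))
      where
      swap : ∀ {a} {X Y : Set a} → X ⊎ Y → Y ⊎ X
      swap = [ inj₂ , inj₁ ]′

  Big : Fin n → Sub n → Set
  Big y H = ∃ λ v → V H v × v ≢ y

  -- Without loops, a connected subgraph whose only vertex is `y` is the point `y`. It is left out
  -- because gluing it on reproduces a subgraph already counted on the other side.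
  nontrivial : ∀ {B y m} → Fam (Rooted B y) (suc m) → Fam (λ H → Rooted B y H × Big y H) m
  nontrivial {B} {y} = Fam-drop {Q = Big y} (λ {H} _ → any? (λ v → V? H v ×-dec ¬? (v ≟ y))) same
    where
    small : ∀ {H K} → Rooted B y H → Rooted B y K → ¬ Big y H → H ≲ K
    small {H} {K} ((ch , _) , hy) (_ , ky) ¬b = fv , λ e → ⊥-elim (adj-irrefl (adj ch e)
        (trans (all (end ch e)) (sym (all (end ch (symm ch e))))))
      where
      all : ∀ {v} → V H v → v ≡ y
      all {v} hv with v ≟ y
      ... | yes eq = eq
      ... | no ne = ⊥-elim (¬b (v , hv , ne))
      fv : ∀ {v} → V H v → V K v
      fv hv with refl ← all hv = ky
    same : ∀ {H K} → Rooted B y H → Rooted B y K → ¬ Big y H → ¬ Big y K → H ≈ K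
    same {H} {K} h k p q = small {H} {K} h k p , small {K} {H} k h q

  -- The root `z` may be far from the gluing vertex `y`. One fixed `H₀` joining the two is enough:
  -- `H₀ ∪ K` determines `K`, and it leaves `A` as soon as `K` is more than the point `y`. Only the
  -- sum of the counts is needed here, not their product.
  join-rooted : ∀ {A B S y z a b} → (∀ {v} → v ∈ A → v ∈ B → v ≡ y) →
    (∀ {v} → v ∈ A → v ∈ S) → (∀ {v} → v ∈ B → v ∈ S) →
    Fam (Rooted A z) a → (Σ (Sub n) λ H → Rooted A y H × V H z) →
    Fam (Rooted B y) (suc b) → Fam (Rooted S z) (a + b)
  join-rooted {A} {B} {S} {y} {z} only A⊆S B⊆S F (H₀ , r₀ , h₀z) F′ =
    Fam-⊎ {P = Rooted A z} {Q = λ L → Rooted S z L × ¬ In A L}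
      (λ ((c , i) , v) → (c , (λ x → A⊆S (i x))) , v) proj₁
      (λ {H} {K} ((_ , i) , _) (_ , ¬i) (_ , p) → ¬i (λ x → i (proj₁ p x)))
      F
      (Fam-map (H₀ ∪_) out
        (λ {H} {K} (h , _) (k , _) → ∪-injʳ only {H₀} {H} {H₀} {K} r₀ h r₀ k)
        (nontrivial F′))
    where
    out : ∀ {K} → Rooted B y K × Big y K → Rooted S z (H₀ ∪ K) × ¬ In A (H₀ ∪ K)
    out {K} (((ck , ik) , ky) , (v , kv , v≢y)) =
      ((∪-conn {H₀} {K} (proj₁ (proj₁ r₀)) ck (proj₂ r₀) ky ,
        ∪-in {S} {H₀} {K} (λ x → A⊆S (proj₂ (proj₁ r₀) x)) (λ x → B⊆S (ik x))) , inj₁ h₀z) ,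
      (λ i → v≢y (only (i (inj₂ kv)) (ik kv)))

  -- `joined` expresses connectedness in the form that `join-rooted` consumes; `whole` carries the
  -- number of subgraphs found so far.
  record Good (A : List (Fin n)) (d k : ℕ) : Set₁ where
    field
      rooted : ∀ {z} → z ∈ A → Fam (Rooted A z) (length A + d)
      joined : ∀ {y z} → y ∈ A → z ∈ A → Σ (Sub n) λ H → Rooted A y H × V H z
      whole  : Fam (Inner A) k

  open Good public

  -- The piece to be glued on at `y`. Its subgraphs that avoid `y` are kept apart in `rest`, since
  -- those through `y` enter the count only in combination with the other side.
  record Block (y : Fin n) (B : List (Fin n)) (d k : ℕ) : Set₁ where
    field
      rooted : ∀ {z} → z ∈ y ∷ B → Fam (Rooted (y ∷ B) z) (suc (length B + d))
      joined : ∀ {x z} → x ∈ y ∷ B → z ∈ y ∷ B → Σ (Sub n) λ H → Rooted (y ∷ B) x H × V H z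
      rest   : Fam (Inner B) k

  positive : ∀ {A : List (Fin n)} {y} d → y ∈ A → ∃ λ a → length A + d ≡ suc a
  positive {_ ∷ A} d _ = length A + d , refl

  -- Three disjoint kinds are counted: inside `A`, inside `B` without `y`, and through `y` while
  -- leaving `A`. The last kind is a product, because a union through `y` determines both of its
  -- parts.
  merge : ∀ {A d k y B d′ k′} → Good A d k → Block y B d′ k′ → y ∈ A →
    (∀ {v} → v ∈ A → v ∉ B) →
    Good (B ++ A) (d′ + d) (k + (k′ + (length A + d) * (length B + d′)))
  merge {A} {d} {k} {y} {B} {d′} {k′} g b y∈A sep = record
    { rooted = λ {z} z∈ → Fam-cast lengths (rt z∈)
    ; joined = jn
    ; whole  = Fam-⊎ {P = Inner A} {Q = λ L → Inner S L × ¬ In A L}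
        (λ (c , i) → c , (λ x → A⊆S (i x))) proj₁
        (λ {H} {K} (_ , i) (_ , ¬i) (_ , p) → ¬i (λ x → i (proj₁ p x)))
        (whole g)
        (Fam-⊎ {P = Inner B} {Q = λ L → (Inner S L × ¬ In A L) × V L y}
          (λ {H} (c , i) → (c , (λ x → ∈-++⁺ˡ (i x))) ,
              (λ j → y∉B (subst (_∈ B) (only (j (proj₂ (ne c))) (there (i (proj₂ (ne c))))) (i (proj₂ (ne c))))))
          proj₁
          (λ {H} {K} (_ , i) (_ , ky) (_ , p) → y∉B (i (proj₁ p ky)))
          (Block.rest b)
          (Fam-× {P = Rooted A y} {Q = λ K → Rooted (y ∷ B) y K × Big y K} _∪_ prod
            (λ {H} {K} {H′} {K′} h (q , _) h′ (q′ , _) → ∪-inj only {H} {K} {H′} {K′} h q h′ q′)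
            (rooted g y∈A) (nontrivial (Block.rooted b (here refl))))) }
    where
    S : List (Fin n)
    S = B ++ A
    A⊆S : ∀ {v} → v ∈ A → v ∈ S
    A⊆S = ∈-++⁺ʳ B
    B⊆S : ∀ {v} → v ∈ y ∷ B → v ∈ S
    B⊆S (here refl) = A⊆S y∈A
    B⊆S (there p)   = ∈-++⁺ˡ p
    only : ∀ {v} → v ∈ A → v ∈ y ∷ B → v ≡ y
    only _ (here eq) = eq
    only a (there b) = ⊥-elim (sep a b)
    y∉B : y ∉ B
    y∉B = sep y∈A
    prod : ∀ {H K} → Rooted A y H → Rooted (y ∷ B) y K × Big y K →
      (Inner S (H ∪ K) × ¬ In A (H ∪ K)) × V (H ∪ K) y
    prod {H} {K} ((ch , ih) , hy) (((ck , ik) , ky) , (v , kv , v≢y)) =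
      ((∪-conn {H} {K} ch ck hy ky , ∪-in {S} {H} {K} (λ x → A⊆S (ih x)) (λ x → B⊆S (ik x))) ,
       (λ i → v≢y (only (i (inj₂ kv)) (ik kv)))) , inj₁ hy
    a₁ : ℕ
    a₁ = length A + d
    sides : ∀ {z} → z ∈ S → (z ∈ y ∷ B) ⊎ (z ∈ A)
    sides z∈ with ∈-++⁻ B z∈
    ... | inj₁ p = inj₁ (there p)
    ... | inj₂ p = inj₂ p
    lengths : a₁ + (length B + d′) ≡ length S + (d′ + d)
    lengths = trans (re (length A) (length B) d d′) (cong (_+ (d′ + d)) (sym (length-++ B)))
      where
      re : ∀ a b d e → (a + d) + (b + e) ≡ (b + a) + (e + d)
      re = solve-∀
    rt : ∀ {z} → z ∈ S → Fam (Rooted S z) (a₁ + (length B + d′))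
    rt {z} z∈ with sides z∈
    ... | inj₂ z∈A = join-rooted only A⊆S B⊆S (rooted g z∈A) (joined g y∈A z∈A)
            (Block.rooted b (here refl))
    -- For a root in the block the roles are exchanged: the connector lies in the block and the
    -- subgraphs of `A` at `y` vary. One member is given up for the point `y`, hence the predecessor
    -- `a`.
    ... | inj₁ z∈B with a , eq ← positive d y∈A =
            Fam-cast (trans (cong suc (+-comm (length B + d′) a)) (cong (_+ (length B + d′)) (sym eq)))
              (join-rooted (λ p q → only q p) B⊆S A⊆S (Block.rooted b z∈B)
                (Block.joined b (here refl) z∈B) (Fam-cast eq (rooted g y∈A)))
    thru : ∀ {u} → u ∈ S → Σ (Sub n) λ H → Rooted S u H × V H y
    thru u∈ with sides u∈
    ... | inj₁ p with K , ((c , i) , v) , w ← Block.joined b p (here refl) = K , ((c , (λ x → B⊆S (i x))) , v) , w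
    ... | inj₂ p with K , ((c , i) , v) , w ← joined g p y∈A = K , ((c , (λ x → A⊆S (i x))) , v) , w
    jn : ∀ {u z} → u ∈ S → z ∈ S → Σ (Sub n) λ H → Rooted S u H × V H z
    jn u∈ z∈ with H , ((c , i) , v) , w ← thru u∈ | K , ((c′ , i′) , v′) , w′ ← thru z∈ =
      H ∪ K , ((∪-conn {H} {K} c c′ w w′ , ∪-in {S} {H} {K} i i′) , inj₁ v) , inj₂ v′

tri : ℕ → ℕ
tri zero    = 0
tri (suc n) = suc n + tri n

-- Connected subgraphs of paths and cycles.

module Cycles {n : ℕ} {G : Graph n} (simple : IsSimple G) where

  open Growth simple

  -- Only the inner vertices are listed, so a cycle is a chain from a vertex to itself without
  -- repeating that vertex in the list.
  data Chain (a : Fin n) : List (Fin n) → Fin n → Set where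
    last : ∀ {b} → T (G a b) → Chain a [] b
    _∷_  : ∀ {w ws b} → T (G a w) → Chain w ws b → Chain a (w ∷ ws) b

  chain-++ : ∀ {a as z bs b} → Chain a as z → Chain z bs b → Chain a (as ++ z ∷ bs) b
  chain-++ (last e) c = e ∷ c
  chain-++ (e ∷ d)  c = e ∷ chain-++ d c

  chain-split : ∀ {a} as {z bs b} → Chain a (as ++ z ∷ bs) b → Chain a as z × Chain z bs b
  chain-split []       (e ∷ c) = last e , c
  chain-split (_ ∷ as) (e ∷ c) = let (p , q) = chain-split as c in e ∷ p , q

  unique-↭ : ∀ {xs ys : List (Fin n)} → xs ↭ ys → Unique xs → Unique ys
  unique-↭ p = PermSetoid.Unique-resp-↭ (setoid (Fin n)) (↭⇒↭ₛ p)

  singleton : ∀ y → Good (y ∷ []) 0 1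
  singleton y = record
    { rooted = λ { (here refl) → Fam-one (pt y) ((pt-conn y , here) , refl) }
    ; joined = λ { (here refl) (here refl) → pt y , ((pt-conn y , here) , refl) , refl }
    ; whole  = Fam-one (pt y) (pt-conn y , here) }

  edge-block : ∀ {y x} → T (G y x) → Block y (x ∷ []) 0 1
  edge-block {y} {x} e = record
    { rooted = λ {z} z∈ → Fam-⊎ {P = λ H → Rooted B z H × H ≲ pt z} {Q = λ H → Rooted B z H × V H y × V H x}
        proj₁ proj₁
        (λ { {H} {K} (_ , p) (_ , ky , kx) (_ , q) →
          adj-irrefl e (trans (proj₁ p (proj₁ q ky)) (sym (proj₁ p (proj₁ q kx)))) })
        (Fam-one (pt z) (((pt-conn z , λ { refl → z∈ }) , refl) , (λ v → v) , λ ()))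
        (Fam-one (ed y x) (((ed-conn e , ed-in) , ed-mem z∈) , inj₁ refl , inj₂ refl))
    ; joined = λ p q → ed y x , ((ed-conn e , ed-in) , ed-mem p) , ed-mem q
    ; rest   = Fam-one (pt x) (pt-conn x , here) }
    where
    B : List (Fin n)
    B = y ∷ x ∷ []
    ed-in : In B (ed y x)
    ed-in (inj₁ refl) = here refl
    ed-in (inj₂ refl) = there (here refl)
    ed-mem : ∀ {z} → z ∈ B → V (ed y x) z
    ed-mem (here refl)         = inj₁ refl
    ed-mem (there (here refl)) = inj₂ refl

  attach : ∀ {A d k y x} → Good A d k → y ∈ A → T (G y x) → x ∉ A →
    Good (x ∷ A) d (k + suc (length A + d))
  attach {A} {d} {k} {x = x} g y∈A e x∉A =
    subst (λ m → Good (x ∷ A) d (k + suc m)) (*-identityʳ (length A + d))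
      (merge g (edge-block e) y∈A (λ { v∈A (here refl) → x∉A v∈A }))

  path-good : ∀ {a ws b} → Chain a ws b → Unique (a ∷ ws) → Good (a ∷ ws) 0 (tri (suc (length ws)))
  path-good (last _) _ = singleton _
  path-good {a} {w ∷ ws} (e ∷ c) u@(_ ∷ u′) =
    subst (Good (a ∷ w ∷ ws) 0)
      (trans (+-comm (tri (suc (length ws))) _) (cong (λ m → suc (suc m) + tri (suc (length ws))) (+-identityʳ (length ws))))
      (attach (path-good c u′) (here refl) (adj-sym e) (Uniq.Unique[x∷xs]⇒x∉xs u))

  path : Fin n → List (Fin n) → Fin n → Sub n
  path a []       b = ed a b
  path a (w ∷ ws) b = ed a w ∪ path w ws b

  path-source : ∀ a ws b → V (path a ws b) a
  path-source a []       b = inj₁ refl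
  path-source a (w ∷ ws) b = inj₁ (inj₁ refl)

  path-target : ∀ a ws b → V (path a ws b) b
  path-target a []       b = inj₂ refl
  path-target a (w ∷ ws) b = inj₂ (path-target w ws b)

  path-conn : ∀ {a ws b} → Chain a ws b → Conn G (path a ws b)
  path-conn (last e) = ed-conn e
  path-conn {a} {w ∷ ws} {b} (e ∷ c) =
    ∪-conn {ed a w} {path w ws b} (ed-conn e) (path-conn c) (inj₂ refl) (path-source w ws b)

  path-in : ∀ a ws b {v} → V (path a ws b) v → v ∈ a ∷ ws ⊎ v ≡ b
  path-in a []       b (inj₁ refl) = inj₁ (here refl)
  path-in a []       b (inj₂ refl) = inj₂ refl
  path-in a (w ∷ ws) b (inj₁ (inj₁ refl)) = inj₁ (here refl)
  path-in a (w ∷ ws) b (inj₁ (inj₂ refl)) = inj₁ (there (here refl))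
  path-in a (w ∷ ws) b (inj₂ p) with path-in w ws b p
  ... | inj₁ q = inj₁ (there q)
  ... | inj₂ q = inj₂ q

  -- The class counted while walking along a chain: `H₀` is the part already fixed, `ws` the
  -- vertices still available.
  Ext : Sub n → List (Fin n) → Sub n → Set
  Ext H₀ ws H = Conn G H × H₀ ≲ H × (∀ {v} → V H v → V H₀ v ⊎ v ∈ ws)

  Ext-there : ∀ {H₀ w ws H} → Ext H₀ ws H → Ext H₀ (w ∷ ws) H
  Ext-there {H₀} {w} {ws} {H} (c , p , q) = c , p , λ v → wk (q v)
    where
    wk : ∀ {v} → V H₀ v ⊎ v ∈ ws → V H₀ v ⊎ v ∈ w ∷ ws
    wk (inj₁ x) = inj₁ x
    wk (inj₂ x) = inj₂ (there x)

  Ext-path : ∀ {H₀ w ws b} → Conn G H₀ → V H₀ b → Chain w ws b → Ext H₀ (w ∷ ws) (H₀ ∪ path w ws b)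
  Ext-path {H₀} {w} {ws} {b} c hb ch =
    ∪-conn {H₀} {path w ws b} c (path-conn ch) hb (path-target w ws b) , (inj₁ , inj₁) , f
    where
    f : ∀ {v} → V H₀ v ⊎ V (path w ws b) v → V H₀ v ⊎ v ∈ w ∷ ws
    f (inj₁ x) = inj₁ x
    f (inj₂ x) with path-in w ws b x
    ... | inj₁ y = inj₂ y
    ... | inj₂ refl = inj₁ hb

  Fresh : Sub n → List (Fin n) → Set
  Fresh H₀ ws = ∀ {v} → v ∈ ws → ¬ V H₀ v

  -- H₀ extended by the final segments of the chain, glued at its target b.
  tails : ∀ {H₀ a ws b} → Chain a ws b → Conn G H₀ → V H₀ b → Fresh H₀ ws → Unique ws →
    Fam (Ext H₀ ws) (suc (length ws))
  tails {H₀} (last _) c hb fr u = Fam-one H₀ (c , ((λ x → x) , (λ x → x)) , inj₁)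
  tails {H₀} {a} {w ∷ ws} {b} (_ ∷ ch) c hb fr u@(_ ∷ u′) =
    Fam-cast (+-comm (suc (length ws)) 1)
      (Fam-⊎ {P = Ext H₀ ws} {Q = λ H → Ext H₀ (w ∷ ws) H × V H w}
        (λ {H} → Ext-there {H₀} {w} {ws} {H}) proj₁
        (λ {H} {K} (_ , _ , q) (_ , kw) (_ , p) →
          [ fr (here refl) , Uniq.Unique[x∷xs]⇒x∉xs u ]′ (q (proj₁ p kw)))
        (tails ch c hb (λ v → fr (there v)) u′)
        (Fam-one (H₀ ∪ path w ws b) (Ext-path {H₀} c hb ch , inj₂ (path-source w ws b))))

  -- The edge `aw` could recur only if the remaining path were the single edge from `w` back to `b`
  -- with `b` equal to `a`, which the last hypothesis excludes.
  path-first-edge : ∀ {a w ws b} → Unique (w ∷ ws) → a ≢ w → a ∉ ws → w ≢ b → (ws ≡ [] → a ≢ b) →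
    ¬ E (path w ws b) a w
  path-first-edge {ws = []} u a≢w a∉ w≢b h (inj₁ (p , _)) = a≢w p
  path-first-edge {ws = []} u a≢w a∉ w≢b h (inj₂ (p , _)) = h refl p
  path-first-edge {ws = x ∷ ws} u a≢w a∉ w≢b h (inj₁ (inj₁ (p , _))) = a≢w p
  path-first-edge {ws = x ∷ ws} u a≢w a∉ w≢b h (inj₁ (inj₂ (p , _))) = a∉ (here p)
  path-first-edge {a} {w} {x ∷ ws} {b} u a≢w a∉ w≢b h (inj₂ e)
    with path-in x ws b (path-ends x ws b e)
    where
    path-ends : ∀ x ws b {u v} → E (path x ws b) u v → V (path x ws b) v
    path-ends x []       b (inj₁ (_ , p)) = inj₂ p
    path-ends x []       b (inj₂ (_ , p)) = inj₁ p
    path-ends x (y ∷ ws) b (inj₁ (inj₁ (_ , p))) = inj₁ (inj₂ p)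
    path-ends x (y ∷ ws) b (inj₁ (inj₂ (_ , p))) = inj₁ (inj₁ p)
    path-ends x (y ∷ ws) b (inj₂ e) = inj₂ (path-ends y ws b e)
  ... | inj₁ q = Uniq.Unique[x∷xs]⇒x∉xs u q
  ... | inj₂ q = w≢b q

  -- The last edge of the chain is not in H₀ by the time it is reached; from two
  -- inner vertices on this is automatic.
  Closing : Sub n → Fin n → List (Fin n) → Fin n → Set
  Closing H₀ a []          b = ¬ E H₀ a b
  Closing H₀ a (_ ∷ [])    b = a ≢ b
  Closing H₀ a (_ ∷ _ ∷ _) b = ⊤

  extend : ∀ {H₀ a w} → Conn G H₀ → V H₀ a → T (G a w) → Conn G (H₀ ∪ ed a w)
  extend {H₀} {a} {w} c ha e = ∪-conn {H₀} {ed a w} c (ed-conn e) ha (inj₁ refl)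

  extend-fresh : ∀ {H₀ a w ws} → V H₀ a → Fresh H₀ (w ∷ ws) → Unique (w ∷ ws) → Fresh (H₀ ∪ ed a w) ws
  extend-fresh ha fr u v∈ (inj₁ x)           = fr (there v∈) x
  extend-fresh ha fr u v∈ (inj₂ (inj₁ refl)) = fr (there v∈) ha
  extend-fresh ha fr u v∈ (inj₂ (inj₂ refl)) = Uniq.Unique[x∷xs]⇒x∉xs u v∈

  extend-closing : ∀ {H₀ a w ws b} → Conn G H₀ → V H₀ b → ¬ V H₀ w → Closing H₀ a (w ∷ ws) b →
    Closing (H₀ ∪ ed a w) w ws b
  extend-closing {ws = []} c hb ¬hw a≢b (inj₁ e) = ¬hw (end c e)
  extend-closing {ws = []} c hb ¬hw a≢b (inj₂ (inj₁ (_ , refl))) = ¬hw hb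
  extend-closing {ws = []} c hb ¬hw a≢b (inj₂ (inj₂ (_ , refl))) = a≢b refl
  extend-closing {ws = _ ∷ []} c hb ¬hw cl refl = ¬hw hb
  extend-closing {ws = _ ∷ _ ∷ _} c hb ¬hw cl = tt

  -- With both ends in `H₀`, an extension along the chain uses every edge or omits one nonempty run
  -- of consecutive edges; a chain with 1 + |ws| edges has `tri (1 + |ws|)` such runs. The recursion
  -- splits on the first edge `aw`: if it is absent, the part kept is a final segment reaching `b`,
  -- possibly all the way from `w`; if it is present, it is moved into `H₀`.
  arcs : ∀ {H₀ a ws b} → Chain a ws b → Conn G H₀ → V H₀ a → V H₀ b → Closing H₀ a ws b →
    Fresh H₀ ws → Unique ws → Fam (Ext H₀ ws) (suc (tri (suc (length ws))))
  arcs {H₀} {a} {[]} {b} (last e) c ha hb cl fr u =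
    Fam-⊎ {P = λ H → Ext H₀ [] H × H ≲ H₀} {Q = λ H → Ext H₀ [] H × E H a b} proj₁ proj₁
      (λ { {H} {K} (_ , p) (_ , ke) (_ , q) → cl (proj₂ p (proj₂ q ke)) })
      (Fam-one H₀ ((c , ((λ x → x) , (λ x → x)) , inj₁) , (λ x → x) , (λ x → x)))
      (Fam-one (H₀ ∪ ed a b) ((extend c ha e , (inj₁ , inj₁) , f) , inj₂ (inj₁ (refl , refl))))
    where
    f : ∀ {v} → V (H₀ ∪ ed a b) v → V H₀ v ⊎ v ∈ []
    f (inj₁ x) = inj₁ x
    f (inj₂ (inj₁ refl)) = inj₁ ha
    f (inj₂ (inj₂ refl)) = inj₁ hb
  arcs {H₀} {a} {w ∷ ws} {b} (e′ ∷ ch) c ha hb cl fr u@(_ ∷ u′) =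
    Fam-cast (cong suc (trans (+-suc (length ws + 1) _)
        (cong (λ m → suc (m + tri (suc (length ws)))) (+-comm (length ws) 1))))
      (Fam-⊎ {P = λ H → Ext H₀ (w ∷ ws) H × ¬ E H a w} {Q = λ H → Ext H₀ (w ∷ ws) H × E H a w}
        proj₁ proj₁
        (λ { (_ , ¬e) (_ , e) (_ , p) → ¬e (proj₂ p e) })
        (Fam-⊎ {P = Ext H₀ ws} {Q = λ H → (Ext H₀ (w ∷ ws) H × V H w) × ¬ E H a w}
          (λ {H} x@(cH , _ , q) → Ext-there {H₀} {w} {ws} {H} x ,
             (λ e → [ fr (here refl) , Uniq.Unique[x∷xs]⇒x∉xs u ]′ (q (end cH (symm cH e)))))
          (λ ((x , _) , y) → x , y)
          (λ {H} {K} (_ , _ , q) ((_ , kw) , _) (_ , p) →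
            [ fr (here refl) , Uniq.Unique[x∷xs]⇒x∉xs u ]′ (q (proj₁ p kw)))
          (tails ch c hb (λ v → fr (there v)) u′)
          (Fam-one (H₀ ∪ path w ws b) ((Ext-path {H₀} c hb ch , inj₂ (path-source w ws b)) , no-edge)))
        (Fam-⊆ (λ (cH , (p , p′) , q) →
            (cH , ((λ x → p (inj₁ x)) , (λ x → p′ (inj₁ x))) , (λ x → relax (q x))) , p′ (inj₂ (inj₁ (refl , refl))))
          (arcs ch (extend c ha e′) (inj₂ (inj₂ refl)) (inj₁ hb)
            (extend-closing {H₀} {a} {w} {ws} {b} c hb (fr (here refl)) cl)
            (extend-fresh {H₀} ha fr u) u′)))
    where
    relax : ∀ {v} → V (H₀ ∪ ed a w) v ⊎ v ∈ ws → V H₀ v ⊎ v ∈ w ∷ ws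
    relax (inj₁ (inj₁ x))           = inj₁ x
    relax (inj₁ (inj₂ (inj₁ refl))) = inj₁ ha
    relax (inj₁ (inj₂ (inj₂ refl))) = inj₂ (here refl)
    relax (inj₂ x)                  = inj₂ (there x)
    a≢b : ∀ {ws} → Closing H₀ a (w ∷ ws) b → ws ≡ [] → a ≢ b
    a≢b cl refl = cl
    no-edge : ¬ E (H₀ ∪ path w ws b) a w
    no-edge (inj₁ e) = fr (here refl) (end c (symm c e))
    no-edge (inj₂ e) = path-first-edge u (adj-irrefl e′) (λ a∈ → fr (there a∈) ha)
      (λ { refl → fr (here refl) hb }) (a≢b cl) e

  record Cyc (y : Fin n) (cs : List (Fin n)) : Set where
    constructor cyc
    field
      chain : Chain y cs y
      uniq  : Unique (y ∷ cs)
      long  : 2 ≤ length cs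

  rotate : ∀ {y cs z} → Cyc y cs → z ∈ y ∷ cs → ∃ λ cs′ → Cyc z cs′ × (z ∷ cs′ ↭ y ∷ cs)
  rotate C (here refl) = _ , C , ↭-refl
  rotate {y} {z = z} (cyc c u l) (there z∈) with as , bs , refl ← ∈-∃++ z∈ =
    bs ++ y ∷ as , cyc (chain-++ (proj₂ sp) (proj₁ sp)) (unique-↭ (↭-sym p) u)
      (subst (2 ≤_) (suc-injective (sym (↭-length p))) l) , p
    where
    p : z ∷ bs ++ y ∷ as ↭ y ∷ as ++ z ∷ bs
    p = ++-comm (z ∷ bs) (y ∷ as)
    sp = chain-split as c

  -- A cycle is a chain from `y` to itself over the one-point subgraph `y`. `Closing` holds because
  -- a cycle has at least two inner vertices.
  cycle-rooted : ∀ {y cs} → Cyc y cs → Fam (Rooted (y ∷ cs) y) (suc (tri (suc (length cs))))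
  cycle-rooted {y} {cs} (cyc c u@(_ ∷ u′) l) =
    Fam-⊆ (λ {H} (cH , p , q) → (cH , (λ v → inside (q v))) , proj₁ p refl)
      (arcs c (pt-conn y) refl refl (closing l) (λ { v∈ refl → Uniq.Unique[x∷xs]⇒x∉xs u v∈ }) u′)
    where
    inside : ∀ {v} → (v ≡ y) ⊎ v ∈ cs → v ∈ y ∷ cs
    inside (inj₁ p) = here p
    inside (inj₂ p) = there p
    closing : ∀ {cs} → 2 ≤ length cs → Closing (pt y) y cs y
    closing {_ ∷ []} (s≤s ())
    closing {_ ∷ _ ∷ _} _ = tt

  -- The same count with one edge fixed, so one edge fewer may be omitted. It serves the count in
  -- K₂,₃, where a subgraph must contain a prescribed neighbour of the root.
  cycle-first-edge : ∀ {y w cs} → Cyc y (w ∷ cs) →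
    Fam (λ H → Rooted (y ∷ w ∷ cs) y H × V H w) (suc (tri (suc (length cs))))
  cycle-first-edge {y} {w} {cs} (cyc (e ∷ c) u@(_ ∷ u′@(_ ∷ u″)) l) =
    Fam-⊆ (λ {H} (cH , p , q) → ((cH , (λ v → inside (q v))) , proj₁ p (inj₁ refl)) , proj₁ p (inj₂ refl))
      (arcs c (ed-conn e) (inj₂ refl) (inj₁ refl) (closing l)
        (λ { v∈ (inj₁ refl) → Uniq.Unique[x∷xs]⇒x∉xs u (there v∈) ; v∈ (inj₂ refl) → Uniq.Unique[x∷xs]⇒x∉xs u′ v∈ }) u″)
    where
    inside : ∀ {v} → (v ≡ y ⊎ v ≡ w) ⊎ v ∈ cs → v ∈ y ∷ w ∷ cs
    inside (inj₁ (inj₁ p)) = here p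
    inside (inj₁ (inj₂ p)) = there (here p)
    inside (inj₂ p)        = there (there p)
    closing : ∀ {cs} → 2 ≤ length (w ∷ cs) → Closing (ed y w) w cs y
    closing {[]} (s≤s ())
    closing {_ ∷ []} _ = λ { refl → adj-irrefl e refl }
    closing {_ ∷ _ ∷ _} _ = tt

  -- For length c, the identity 1 + tri c = c + (1 + tri (c - 1)) turns the rooted count into the
  -- surplus. Deleting `y` leaves a path, which gives `rest`.
  cycle-block : ∀ {y cs} → Cyc y cs → Block y cs (suc (tri (length cs))) (tri (length cs))
  cycle-block {y} {cs} C@(cyc c u l) = record
    { rooted = λ z∈ → let (cs′ , C′ , p) = rotate C z∈ in
        Fam-cast (cong suc (trans (cong (λ m → tri m) (↭-length p)) (sym (+-suc (length cs) _))))
          (Fam-⊆ (λ ((cH , i) , v) → (cH , (λ x → ∈-resp-↭ p (i x))) , v) (cycle-rooted C′))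
    ; joined = joined (path-good c u)
    ; rest   = rest c u }
    where
    rest : ∀ {cs} → Chain y cs y → Unique (y ∷ cs) → Fam (Inner cs) (tri (length cs))
    rest (last _) _       = fam (λ ()) (λ ()) (λ { {()} })
    rest (_ ∷ c)  (_ ∷ u) = whole (path-good c u)

-- Numerical inequalities and facts on duplicate-free lists.

≤-by : ∀ {a b} c → a + c ≡ b → a ≤ b
≤-by c refl = m≤m+n _ c

-- For a cycle on m + 1 vertices with `t` vertices off it, `t` times the difference of the two sides
-- is twice the excess of the count over n² + 1. At m = 4 the inequality holds exactly up to t = 13.
quadratic-≤ : ∀ {m t} → 4 ≤ m → t ≤ 12 → t + 2 * m ≤ 1 + m * m + m
quadratic-≤ {m} {t} 4≤m t≤12 with j , eq ← m≤n⇒∃[o]m+o≡n 4≤m =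
  ≤-trans (+-monoˡ-≤ (2 * m) t≤12) (subst (λ m → 12 + 2 * m ≤ 1 + m * m + m) eq (≤-by (1 + 7 * j + j * j) (re j)))
  where
  re : ∀ j → 12 + 2 * (4 + j) + (1 + 7 * j + j * j) ≡ 1 + (4 + j) * (4 + j) + (4 + j)
  re = solve-∀

-- Twice the comparison of 8n with (1 + tri m)(t + 1), where n = m + 1 + t. The threshold 13 makes t
-- + 1 at least 14, which absorbs the term 14m.
cubic-≤ : ∀ {m t} → 4 ≤ m → 13 ≤ t → 2 * (8 * (suc m + t)) ≤ (2 + m * suc m) * suc t
cubic-≤ {m} {t} 4≤m 13≤t = begin
  2 * (8 * (suc m + t))
    ≡⟨ re₁ m t ⟩
  2 * m + (14 + 14 * t) + (14 * m + 2 * suc t)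
    ≤⟨ +-mono-≤ (+-mono-≤ (*-monoˡ-≤ m (≤-trans (s≤s (s≤s z≤n)) 4≤m)) linear)
         (+-monoˡ-≤ (2 * suc t) (*-monoˡ-≤ m (s≤s 13≤t))) ⟩
  m * m + m * m * t + (suc t * m + 2 * suc t)
    ≡⟨ re₂ m t ⟩
  (2 + m * suc m) * suc t ∎
  where
  open ≤-Reasoning
  re₁ : ∀ m t → 2 * (8 * (suc m + t)) ≡ 2 * m + (14 + 14 * t) + (14 * m + 2 * suc t)
  re₁ = solve-∀
  re₂ : ∀ m t → m * m + m * m * t + (suc t * m + 2 * suc t) ≡ (2 + m * suc m) * suc t
  re₂ = solve-∀
  linear : 14 + 14 * t ≤ m * m * t
  linear = begin
    14 + 14 * t     ≤⟨ +-monoˡ-≤ (14 * t) (*-monoʳ-≤ 2 (≤-trans (m≤m+n 7 6) 13≤t)) ⟩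
    2 * t + 14 * t  ≡⟨ *-distribʳ-+ t 2 14 ⟨
    16 * t          ≤⟨ *-monoˡ-≤ t (*-mono-≤ 4≤m 4≤m) ⟩
    m * m * t       ∎

tri-double : ∀ n → tri n + tri n ≡ n * suc n
tri-double zero    = refl
tri-double (suc n) = trans (re n (tri n)) (trans (cong (λ s → s + 2 * suc n) (tri-double n)) (re′ n))
  where
  re : ∀ n t → (suc n + t) + (suc n + t) ≡ (t + t) + 2 * suc n
  re = solve-∀
  re′ : ∀ n → n * suc n + 2 * suc n ≡ suc n * suc (suc n)
  re′ = solve-∀

tri-+ : ∀ m p → tri (m + p) ≡ tri m + tri p + m * p
tri-+ zero    p = sym (+-identityʳ _)
tri-+ (suc m) p = trans (cong (suc (m + p) +_) (tri-+ m p)) (re m p (tri m) (tri p))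
  where
  re : ∀ m p s t → suc (m + p) + (s + t + m * p) ≡ suc m + s + t + suc m * p
  re = solve-∀

tri-mono : ∀ {m n} → m ≤ n → tri m ≤ tri n
tri-mono z≤n       = z≤n
tri-mono (s≤s m≤n) = +-mono-≤ (s≤s m≤n) (tri-mono m≤n)

unique-++⁻ : ∀ {A : Set} xs {ys : List A} → Unique (xs ++ ys) →
  Unique xs × Unique ys × (∀ {v} → v ∈ xs → v ∉ ys)
unique-++⁻ []       u = [] , u , λ ()
unique-++⁻ (x ∷ xs) {ys} (a ∷ u) with ux , uy , d ← unique-++⁻ xs u =
  AllP.++⁻ˡ xs a ∷ ux , uy , λ { (here refl) q → All.lookup (AllP.++⁻ʳ xs a) q refl ; (there p) q → d p q }

unique-lookup : ∀ {A : Set} {xs : List A} → Unique xs → ∀ {i j} → lookup xs i ≡ lookup xs j → i ≡ j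
unique-lookup (a ∷ u) {zero}  {zero}  eq = refl
unique-lookup (a ∷ u) {zero}  {suc j} eq = ⊥-elim (All.lookup a (∈-lookup j) eq)
unique-lookup (a ∷ u) {suc i} {zero}  eq = ⊥-elim (All.lookup a (∈-lookup i) (sym eq))
unique-lookup (a ∷ u) {suc i} {suc j} eq = cong suc (unique-lookup u eq)

unique-length : ∀ {n} {xs : List (Fin n)} → Unique xs → length xs ≤ n
unique-length u = injective⇒≤ (unique-lookup u)

covering-length : ∀ {n} {xs : List (Fin n)} → (∀ v → v ∈ xs) → n ≤ length xs
covering-length {xs = xs} f = injective⇒≤ {f = λ v → index (f v)}
  (λ {u} {v} eq → trans (lookup-index (f u)) (trans (cong (lookup xs) eq) (sym (lookup-index (f v)))))

_∈?_ : ∀ {n} (v : Fin n) xs → Dec (v ∈ xs)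
_∈?_ = member? _≟_

outside : ∀ {n} (xs : List (Fin n)) → length xs < n → ∃ λ v → v ∉ xs
outside xs lt with any? (λ v → ¬? (v ∈? xs))
... | yes p = p
... | no ¬p = ⊥-elim (<⇒≱ lt (covering-length all))
  where
  all : ∀ v → v ∈ xs
  all v with v ∈? xs
  ... | yes q = q
  ... | no ¬q = ⊥-elim (¬p (v , ¬q))

-- The lower bound: growing dense sets, finding second cycles and ears.

module Ears {n : ℕ} {G : Graph n} (simple : IsSimple G) (connected : Connected G) (no-pendant : NoPendant G) where

  open Growth simple
  open Cycles simple

  -- The deficit e records by how much the count falls short of tri |A| + d |A|;
  -- unlike the count itself, it does not change when A grows by pendant edges.
  Dense : List (Fin n) → ℕ → ℕ → Set₁
  Dense A d e = Σ ℕ λ k → Good A d k × tri (length A) + d * length A ≤ k + e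

  -- The product in `merge` contains the extra term dδ, while the new target asks for δ|B| more than
  -- is available; so the deficit changes by δ|B| - dδ. It is unchanged for a pendant edge, where δ
  -- = 0.
  dense-merge : ∀ {A d e y B δ e′} → Dense A d e → Block y B δ (tri (length B)) → y ∈ A →
    (∀ {v} → v ∈ A → v ∉ B) → δ * length B + e ≤ d * δ + e′ → Dense (B ++ A) (δ + d) e′
  dense-merge {A} {d} {e} {y} {B} {δ} {e′} (k , g , le) b y∈A sep c = _ , merge g b y∈A sep ,
    (begin
      tri (length (B ++ A)) + (δ + d) * length (B ++ A)
        ≡⟨ cong (λ s → tri s + (δ + d) * s) (length-++ B) ⟩
      tri (m + p) + (δ + d) * (m + p)
        ≡⟨ cong (_+ (δ + d) * (m + p)) (tri-+ m p) ⟩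
      tri m + tri p + m * p + (δ + d) * (m + p)
        ≡⟨ re₁ m p δ d (tri m) (tri p) ⟩
      tri p + d * p + (tri m + m * p + δ * m + δ * p + d * m)
        ≤⟨ +-monoˡ-≤ _ le ⟩
      k + e + (tri m + m * p + δ * m + δ * p + d * m)
        ≡⟨ re₂ k e m p δ d (tri m) ⟨
      δ * m + e + (k + tri m + m * p + δ * p + d * m)
        ≤⟨ +-monoˡ-≤ _ c ⟩
      d * δ + e′ + (k + tri m + m * p + δ * p + d * m)
        ≡⟨ re₃ k e′ m p δ d (tri m) ⟩
      k + (tri m + (p + d) * (m + δ)) + e′ ∎)
    where
    open ≤-Reasoning
    m = length B
    p = length A
    re₁ : ∀ m p δ d s t → s + t + m * p + (δ + d) * (m + p) ≡ t + d * p + (s + m * p + δ * m + δ * p + d * m)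
    re₁ = solve-∀
    re₂ : ∀ k e m p δ d s → δ * m + e + (k + s + m * p + δ * p + d * m) ≡ k + e + (s + m * p + δ * m + δ * p + d * m)
    re₂ = solve-∀
    re₃ : ∀ k e m p δ d s → d * δ + e + (k + s + m * p + δ * p + d * m) ≡ k + (s + (p + d) * (m + δ)) + e
    re₃ = solve-∀

  dense-attach : ∀ {A d e y x} → Dense A d e → y ∈ A → T (G y x) → x ∉ A → Dense (x ∷ A) d e
  dense-attach {d = d} {e} D y∈A adj x∉A = dense-merge D (edge-block adj) y∈A
    (λ { v∈A (here refl) → x∉A v∈A }) (m≤n+m e (d * 0))

  dense-cycle : ∀ {y cs} → Cyc y cs → Dense (cs ++ y ∷ []) (suc (tri (length cs))) (suc (tri (length cs)) * length cs)
  dense-cycle {y} {cs} C = subst (λ d → Dense (cs ++ y ∷ []) d (suc (tri (length cs)) * length cs)) (+-identityʳ _)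
    (dense-merge {e = 0} (1 , singleton y , ≤-refl) (cycle-block C) (here refl)
      (λ { (here refl) v∈ → Uniq.Unique[x∷xs]⇒x∉xs (Cyc.uniq C) v∈ }) (≤-reflexive (+-identityʳ _)))

  -- Every vertex at which the walk leaves the current set is joined by a pendant edge to its
  -- predecessor on the walk, so surplus and deficit are preserved.
  absorb : ∀ {A d e y v} → Dense A d e → y ∈ A → Walk G y v →
    Σ (List (Fin n)) λ A′ → Dense A′ d e × (∀ {u} → u ∈ A → u ∈ A′) × v ∈ A′
  absorb D y∈A here = _ , D , (λ u → u) , y∈A
  absorb {A} D y∈A (step {v = x} e w) with x ∈? A
  ... | yes x∈A = absorb D x∈A w
  ... | no x∉A with A′ , D′ , sub , v∈ ← absorb (dense-attach D y∈A e x∉A) (here refl) w =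
          A′ , D′ , (λ u → sub (there u)) , v∈

  absorb-all : ∀ {A d e y} → Dense A d e → y ∈ A → (vs : List (Fin n)) →
    Σ (List (Fin n)) λ A′ → Dense A′ d e × (∀ {u} → u ∈ A → u ∈ A′) × (∀ {u} → u ∈ vs → u ∈ A′)
  absorb-all D y∈A [] = _ , D , (λ u → u) , λ ()
  absorb-all D y∈A (v ∷ vs)
    with A₁ , D₁ , s₁ , v∈ ← absorb D y∈A (connected _ v)
    with A₂ , D₂ , s₂ , vs∈ ← absorb-all D₁ (s₁ y∈A) vs =
      A₂ , D₂ , (λ u → s₂ (s₁ u)) , λ { (here refl) → s₂ v∈ ; (there u) → vs∈ u }

  exit : ∀ {A y v} → y ∈ A → v ∉ A → Walk G y v → ∃ λ a → ∃ λ b → a ∈ A × b ∉ A × T (G a b)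
  exit y∈A v∉A here = ⊥-elim (v∉A y∈A)
  exit {A} y∈A v∉A (step {v = x} e w) with x ∈? A
  ... | yes x∈A = exit x∈A v∉A w
  ... | no x∉A  = _ , x , y∈A , x∉A , e

  -- The duplicate-free list of neighbours of `x` contains `p` and does not have length 1, so one of
  -- its first two entries differs from `p`.
  second-neighbour : ∀ {x p} → T (G x p) → ∃ λ w → T (G x w) × w ≢ p
  second-neighbour {x} {p} e =
    find (Uniq.filter⁺ (λ v → T? (G x v)) (Uniq.allFin⁺ n)) (λ v∈ → proj₂ (∈-filter⁻ (λ v → T? (G x v)) {xs = allFin n} v∈))
      (∈-filter⁺ (λ v → T? (G x v)) (∈-allFin p) e) (no-pendant x)
    where
    find : ∀ {l} → Unique l → (∀ {v} → v ∈ l → T (G x v)) → p ∈ l → length l ≢ 1 → ∃ λ w → T (G x w) × w ≢ p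
    find {_ ∷ []} u f p∈ ne = ⊥-elim (ne refl)
    find {a ∷ b ∷ _} u f p∈ ne with a ≟ p
    ... | no a≢p = a , f (here refl) , a≢p
    find {a ∷ b ∷ _} ((a≢b ∷ _) ∷ _) f p∈ ne | yes refl = b , f (there (here refl)) , λ { refl → a≢b refl }

  dense-stem : ∀ {B w bs y} → Chain w bs y → Unique (w ∷ bs) → (∀ {v} → v ∈ w ∷ bs → v ∉ B) → y ∈ B →
    ∀ {d e} → Dense B d e → Dense (w ∷ bs ++ B) d e
  dense-stem (last e) u av y∈B D = dense-attach D y∈B (adj-sym e) (av (here refl))
  dense-stem {B} {w} {b ∷ bs} (e ∷ c) U@(_ ∷ u) av y∈B D =
    dense-attach (dense-stem c u (λ v → av (there v)) y∈B D) (here refl) (adj-sym e)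
      (λ w∈ → [ Uniq.Unique[x∷xs]⇒x∉xs U , av (here refl) ]′ (∈-++⁻ (b ∷ bs) w∈))

  -- `tied` is a cycle meeting `B` together with a stem `st` in exactly one vertex; the stem is
  -- empty if the path closes at `y`. The stem consists of pendant edges, hence the transport for
  -- all `d` and `e`. `ear` returns to `B` at a vertex other than `y`.
  data Outcome (B : List (Fin n)) (y : Fin n) : Set₁ where
    tied : ∀ {w cs st} → Cyc w cs → (∀ {v} → v ∈ st ++ B → v ∉ cs) → w ∈ st ++ B →
      (∀ {d e} → Dense B d e → Dense (st ++ B) d e) → Outcome B y
    ear  : ∀ {x ws w} → Chain x ws y → Unique (x ∷ ws) → (∀ {v} → v ∈ x ∷ ws → v ∉ B) →
      w ∈ B → w ≢ y → T (G x w) → Outcome B y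

  prev : ∀ {x ws y} → Chain x ws y → Fin n
  prev {ws = []}    {y} _ = y
  prev {ws = w ∷ _} {y} _ = w

  prev-adj : ∀ {x ws y} (c : Chain x ws y) → T (G x (prev c))
  prev-adj (last e) = e
  prev-adj (e ∷ _)  = e

  -- Prolong the path without turning back until it meets itself or B.
  search : ∀ {B x ws y} fuel → Chain x ws y → Unique (x ∷ ws) → (∀ {v} → v ∈ x ∷ ws → v ∉ B) → y ∈ B →
    n < fuel + length (x ∷ ws) → Outcome B y
  -- Each prolongation adds a new vertex, so running out of fuel would give more than `n` distinct
  -- vertices.
  search zero c u av y∈B lt = ⊥-elim (<⇒≱ lt (unique-length u))
  search {B} {x} {ws} {y} (suc fuel) c u av y∈B lt with second-neighbour (prev-adj c)
  ... | w , e , w≢p with w ∈? B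
  search {B} {x} {ws} {y} (suc fuel) c u av y∈B lt | w , e , w≢p | yes w∈B with w ≟ y
  ... | no w≢y = ear c u av w∈B w≢y e
  ... | yes refl = tied {st = []} (cyc (adj-sym e ∷ c) (All.tabulate (λ v∈ → λ { refl → av v∈ y∈B }) ∷ u) (big c w≢p))
                     (λ v∈B v∈ → av v∈ v∈B) y∈B (λ D → D)
    where
    big : ∀ {ws} (c : Chain x ws y) → y ≢ prev c → 2 ≤ suc (length ws)
    big (last e) ne = ⊥-elim (ne refl)
    big (_ ∷ _) _   = s≤s (s≤s z≤n)
  search {B} {x} {ws} {y} (suc fuel) c u av y∈B lt | w , e , w≢p | no w∉B with w ∈? ws
  ... | no w∉ws = search fuel (adj-sym e ∷ c)
          (All.tabulate (λ { (here refl) refl → adj-irrefl e refl ; (there v∈) refl → w∉ws v∈ }) ∷ u)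
          (λ { (here refl) → w∉B ; (there v∈) → av v∈ }) y∈B (subst (n <_) (sym (+-suc fuel _)) lt)
  ... | yes w∈ws = lasso c u av w≢p (∈-∃++ w∈ws)
    where
    lasso : ∀ {ws} (c : Chain x ws y) → Unique (x ∷ ws) → (∀ {v} → v ∈ x ∷ ws → v ∉ B) → w ≢ prev c →
      (∃ λ as → ∃ λ bs → ws ≡ as ++ w ∷ bs) → Outcome B y
    -- If `w` headed `ws`, it would be the vertex just left, and the path would turn back.
    lasso c u av ne ([] , bs , refl) = ⊥-elim (ne refl)
    lasso c u av ne (a ∷ as , bs , refl) with
      ca , cb ← chain-split (a ∷ as) c | ua , ub , d ← unique-++⁻ (x ∷ a ∷ as) u =
      tied {st = w ∷ bs}
        (cyc (adj-sym e ∷ ca) (All.tabulate (λ { v∈ refl → d v∈ (here refl) }) ∷ ua) (s≤s (s≤s z≤n)))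
        (λ v∈ v∈′ → [ d v∈′ , av (∈-++⁺ˡ v∈′) ]′ (∈-++⁻ (w ∷ bs) v∈))
        (here refl)
        (dense-stem cb ub (λ v∈ → av (∈-++⁺ʳ (x ∷ a ∷ as) v∈)) y∈B)

  sprout : ∀ {B a b} → a ∈ B → b ∉ B → T (G a b) → Outcome B a
  sprout a∈ b∉ e = search n (last (adj-sym e)) ([] ∷ []) (λ { (here refl) → b∉ }) a∈ (≤-reflexive (+-comm 1 n))

  module _ {k : ℕ} (total : ∀ {m} → Fam (Conn G) m → m ≤ k) (5≤n : 5 ≤ n) where

    Bound : Set
    Bound = (n * n + 1 ≤ k) ⊎ (tri n + 8 * n ≤ k)

    -- After absorbing every vertex the list has length at least `n`, and the estimate is monotone
    -- in the length.
    dense-bound : ∀ {A d e y} → Dense A d e → y ∈ A → tri n + d * n ≤ k + e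
    dense-bound {d = d} {e} D y∈A with A′ , (m , g , le) , _ , all ← absorb-all D y∈A (allFin n) =
      ≤-trans (+-mono-≤ (tri-mono n≤) (*-monoʳ-≤ d n≤))
        (≤-trans le (+-monoˡ-≤ e (total (Fam-⊆ proj₁ (whole g)))))
      where
      n≤ : n ≤ length A′
      n≤ = covering-length (λ v → all (∈-allFin v))

    -- Each unit of surplus beyond 8 is worth `n`, which pays for the deficit.
    finish : ∀ {A c e y} → Dense A (8 + c) e → y ∈ A → e ≤ c * n → Bound
    finish {c = c} {e} D y∈A e≤ = inj₂ (+-cancelʳ-≤ (c * n) _ _
      (≤-trans (≤-reflexive (re (tri n) n c)) (≤-trans (dense-bound D y∈A) (+-monoʳ-≤ k e≤))))
      where
      re : ∀ t n c → t + 8 * n + c * n ≡ t + (8 + c) * n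
      re = solve-∀

    drop-cycle : ∀ m t → n ≡ suc m + t → tri n + suc (tri m) * n ≤ k + suc (tri m) * m →
      tri n + suc (tri m) * suc t ≤ k
    drop-cycle m t eq h = +-cancelʳ-≤ (suc (tri m) * m) _ _
      (subst (_≤ k + suc (tri m) * m) (trans (cong (λ i → tri n + suc (tri m) * i) eq) (re (tri n) (tri m) m t)) h)
      where
      re : ∀ s τ m t → s + suc τ * (suc m + t) ≡ s + suc τ * suc t + suc τ * m
      re = solve-∀

    -- With few vertices off the cycle the count is compared with n² + 1, with equality at t = 0;
    -- with many it is compared with `tri n + 8 * n`.
    long-arith : ∀ m t → 4 ≤ m → n ≡ suc m + t → tri n + suc (tri m) * n ≤ k + suc (tri m) * m → Bound
    long-arith m t 4≤m eq h with t ≤? 12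
    ... | yes t≤12 = inj₁ (≤-trans (*-cancelˡ-≤ 2 double) h′)
      where
      open ≤-Reasoning
      h′ : tri n + suc (tri m) * suc t ≤ k
      h′ = drop-cycle m t eq h
      double : 2 * (n * n + 1) ≤ 2 * (tri n + suc (tri m) * suc t)
      -- Doubling removes the halves in `tri`; the padding on both sides avoids a subtraction.
      double = +-cancelʳ-≤ (t * (t + 2 * m)) _ _ (begin
        2 * (n * n + 1) + t * (t + 2 * m)
          ≤⟨ +-monoʳ-≤ (2 * (n * n + 1)) (*-monoʳ-≤ t (quadratic-≤ 4≤m t≤12)) ⟩
        2 * (n * n + 1) + t * (1 + m * m + m)
          ≡⟨ cong (λ i → 2 * (i * i + 1) + t * (1 + m * m + m)) eq ⟩
        2 * ((suc m + t) * (suc m + t) + 1) + t * (1 + m * m + m)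
          ≡⟨ re m t ⟩
        (suc m + t) * suc (suc m + t) + (2 + m * suc m) * suc t + t * (t + 2 * m)
          ≡⟨ cong₂ (λ a b → a + (2 + b) * suc t + t * (t + 2 * m)) (trans (tri-double n) (cong (λ i → i * suc i) eq)) (tri-double m) ⟨
        tri n + tri n + (2 + (tri m + tri m)) * suc t + t * (t + 2 * m)
          ≡⟨ cong (_+ t * (t + 2 * m)) (re₂ (tri n) (tri m) t) ⟨
        2 * (tri n + suc (tri m) * suc t) + t * (t + 2 * m) ∎)
        where
        re : ∀ m t → 2 * ((suc m + t) * (suc m + t) + 1) + t * (1 + m * m + m) ≡
          (suc m + t) * suc (suc m + t) + (2 + m * suc m) * suc t + t * (t + 2 * m)
        re = solve-∀
        re₂ : ∀ s τ t → 2 * (s + suc τ * suc t) ≡ s + s + (2 + (τ + τ)) * suc t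
        re₂ = solve-∀
    ... | no t≰12 = inj₂ (≤-trans (+-monoʳ-≤ (tri n) (*-cancelˡ-≤ 2 double)) (drop-cycle m t eq h))
      where
      open ≤-Reasoning
      double : 2 * (8 * n) ≤ 2 * (suc (tri m) * suc t)
      double = begin
        2 * (8 * n)                       ≡⟨ cong (λ i → 2 * (8 * i)) eq ⟩
        2 * (8 * (suc m + t))             ≤⟨ cubic-≤ 4≤m (≰⇒> t≰12) ⟩
        (2 + m * suc m) * suc t           ≡⟨ cong (λ a → (2 + a) * suc t) (tri-double m) ⟨
        (2 + (tri m + tri m)) * suc t     ≡⟨ re (tri m) t ⟨
        2 * (suc (tri m) * suc t)         ∎
        where
        re : ∀ τ t → 2 * (suc τ * suc t) ≡ (2 + (τ + τ)) * suc t
        re = solve-∀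

    long-cycle : ∀ {y cs} → Cyc y cs → 4 ≤ length cs → Bound
    long-cycle {y} {cs} C l with t , eq ← m≤n⇒∃[o]m+o≡n (unique-length (Cyc.uniq C)) =
      long-arith (length cs) t l (sym eq) (dense-bound (dense-cycle C) (∈-++⁺ʳ cs (here refl)))

    -- Surplus and deficit of a triangle and of a 4-cycle.
    Tame : ℕ → ℕ → Set
    Tame d e = (d ≡ 4 × e ≡ 8) ⊎ (d ≡ 7 × e ≡ 21)

    -- By the rule δ|B| - dδ for deficits: two triangles give surplus 8 and deficit 8 + 8 - 16 = 0;
    -- a triangle and a 4-cycle give surplus 11 and deficit 29 - 28 = 1; two 4-cycles give surplus
    -- 14, with 42 covered by 49. Two triangles leave no slack at all, as they must.
    second-cycle : ∀ {A d e w cs} → Tame d e → Dense A d e → Cyc w cs → w ∈ A → (∀ {v} → v ∈ A → v ∉ cs) → Bound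
    second-cycle {cs = _ ∷ []} _ _ (cyc _ _ (s≤s ()))
    second-cycle {cs = cs@(_ ∷ _ ∷ [])} (inj₁ (refl , refl)) D C w∈ sep =
      finish {c = 0} {0} (dense-merge {e′ = 0} D (cycle-block C) w∈ sep ≤-refl) (∈-++⁺ʳ cs w∈) z≤n
    second-cycle {cs = cs@(_ ∷ _ ∷ [])} (inj₂ (refl , refl)) D C w∈ sep =
      finish {c = 3} {1} (dense-merge {e′ = 1} D (cycle-block C) w∈ sep ≤-refl) (∈-++⁺ʳ cs w∈)
        (*-mono-≤ {1} {3} (s≤s z≤n) (≤-trans (s≤s z≤n) 5≤n))
    second-cycle {cs = cs@(_ ∷ _ ∷ _ ∷ [])} (inj₁ (refl , refl)) D C w∈ sep =
      finish {c = 3} {1} (dense-merge {e′ = 1} D (cycle-block C) w∈ sep ≤-refl) (∈-++⁺ʳ cs w∈)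
        (*-mono-≤ {1} {3} (s≤s z≤n) (≤-trans (s≤s z≤n) 5≤n))
    second-cycle {cs = cs@(_ ∷ _ ∷ _ ∷ [])} (inj₂ (refl , refl)) D C w∈ sep =
      finish {c = 6} {0} (dense-merge {e′ = 0} D (cycle-block C) w∈ sep (toWitness {a? = 42 ≤? 49} tt)) (∈-++⁺ʳ cs w∈) z≤n
    second-cycle {cs = _ ∷ _ ∷ _ ∷ _ ∷ _} _ D C w∈ sep = long-cycle C (s≤s (s≤s (s≤s (s≤s z≤n))))

    -- The ear from `x` to `y` is closed through `B`; the last edge of the second chain leads from
    -- the landing vertex of the ear back to `x`.
    ear-cycle : ∀ {B x ws y r rs} → Chain x ws y → Unique (x ∷ ws) → (∀ {v} → v ∈ x ∷ ws → v ∉ B) →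
      Chain y (r ∷ rs) x → Unique (y ∷ r ∷ rs) → (∀ {v} → v ∈ y ∷ r ∷ rs → v ∈ B) → Cyc x (ws ++ y ∷ r ∷ rs)
    ear-cycle {ws = ws} {y} {r} {rs} c u av c′ u′ sub = cyc (chain-++ c c′)
      (Uniq.++⁺ u u′ (λ (p , q) → av p (sub q)))
      (subst (2 ≤_) (sym (length-++ ws)) (≤-trans (s≤s (s≤s z≤n)) (m≤n+m (length (y ∷ r ∷ rs)) (length ws))))

    ear-length : ∀ (ws : List (Fin n)) {l : List (Fin n)} m → 4 ≤ length ws + m → length l ≡ m → 4 ≤ length (ws ++ l)
    ear-length ws m p refl = subst (4 ≤_) (sym (length-++ ws)) p

    -- 18 = 11 + 7: the subgraphs of a 4-cycle through z, and those through z and b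
    -- prolonged to w.
    k23-rooted : ∀ {z b cs c w S} → Cyc z (b ∷ cs) → length cs ≡ 2 → T (G c w) →
      (∀ {H} → V H z → V H b → V H c) → w ∉ z ∷ b ∷ cs → (∀ {v} → v ∈ w ∷ z ∷ b ∷ cs → v ∈ S) →
      Fam (Rooted S z) 18
    k23-rooted {z} {b} {cs} {c} {w} {S} C eq e at w∉ sub =
      Fam-⊎ {P = Rooted A z} {Q = λ H → Rooted S z H × V H w}
        (λ ((cH , i) , v) → (cH , (λ x → sub (there (i x)))) , v) proj₁
        (λ ((_ , i) , _) (_ , kw) (_ , p) → w∉ (i (proj₁ p kw)))
        (Fam-cast (cong (λ l → suc (tri (suc (suc l)))) eq) (cycle-rooted C))
        (Fam-map (_∪ ed c w)
          (λ {H} (((cH , i) , hz) , hb) →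
            ((∪-conn {H} {ed c w} cH (ed-conn e) (at {H} hz hb) (inj₁ refl) ,
              (λ { (inj₁ x) → sub (there (i x)) ; (inj₂ (inj₁ refl)) → sub (there (i (at {H} hz hb)))
                 ; (inj₂ (inj₂ refl)) → sub (here refl) })) , inj₁ hz) , inj₂ (inj₂ refl))
          (λ {H} {K} ((h , hz) , hb) ((k , kz) , kb) (p , q) →
            back {H} {K} h (at {K} kz kb) p , back {K} {H} k (at {H} hz hb) q)
          (Fam-cast (cong (λ l → suc (tri (suc l))) eq) (cycle-first-edge C)))
      where
      A : List (Fin n)
      A = z ∷ b ∷ cs
      back : ∀ {H K} → Inner A H → V K c → H ∪ ed c w ≲ K ∪ ed c w → H ≲ K
      back {H} {K} h kc p = recover {A = c ∷ w ∷ []} {B = A} {H = ed c w} {H} {K}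
        (λ { (here refl) _ → refl ; (there (here refl)) w∈ → ⊥-elim (w∉ w∈) })
        (ed-conn e , (λ { (inj₁ refl) → here refl ; (inj₂ refl) → there (here refl) })) h kc
        (∪-comm-≲ {K} {ed c w} {H} (∪-left {H} {ed c w} {K ∪ ed c w} p))

    -- The parts of K₂,₃ are {y, q} and {p, r, x}. For each of the five roots some 4-cycle through
    -- it misses one vertex, and that vertex hangs on the root or on its first neighbour along the
    -- cycle; this gives 18 subgraphs per root. The total is 35 = 17 + 18: those of the 4-cycle
    -- without `x`, and those through `x`.
    k23 : ∀ {y p q r x} → 12 ≤ n → Cyc y (p ∷ q ∷ r ∷ []) → x ∉ p ∷ q ∷ r ∷ y ∷ [] → T (G x y) → T (G x q) → Bound
    k23 {y} {p} {q} {r} {x} 12≤n C@(cyc (yp ∷ pq ∷ qr ∷ last ry) ((y≢p ∷ y≢q ∷ y≢r ∷ []) ∷ (p≢q ∷ p≢r ∷ []) ∷ (q≢r ∷ []) ∷ [] ∷ []) _) x∉ xy xq =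
      -- The surplus is 18 - 5 = 13 = 8 + 5, and tri 5 + 13 * 5 = 80 = 35 + 45. The deficit 45 is at
      -- most 5n from n = 9 on.
      finish {A = S} {c = 5} {45} (35 , record { rooted = rt ; joined = joined g₅ ; whole = wh } , ≤-refl)
        (here refl) (≤-trans (toWitness {a? = 45 ≤? 60} tt) (*-monoʳ-≤ 5 12≤n))
      where
      S : List (Fin n)
      S = x ∷ p ∷ q ∷ r ∷ y ∷ []
      g₄ : Good (p ∷ q ∷ r ∷ y ∷ []) 7 17
      g₄ = merge (singleton y) (cycle-block C) (here refl)
        (λ { (here refl) v∈ → Uniq.Unique[x∷xs]⇒x∉xs (Cyc.uniq C) v∈ })
      g₅ : Good S 7 _
      g₅ = attach g₄ (there (there (there (here refl)))) (adj-sym xy) x∉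
      x≢y : x ≢ y
      x≢y refl = x∉ (there (there (there (here refl))))
      x≢p : x ≢ p
      x≢p refl = x∉ (here refl)
      x≢q : x ≢ q
      x≢q refl = x∉ (there (here refl))
      x≢r : x ≢ r
      x≢r refl = x∉ (there (there (here refl)))
      2≤3 : 2 ≤ 3
      2≤3 = s≤s (s≤s z≤n)
      ∈x : x ∈ S
      ∈x = here refl
      ∈p : p ∈ S
      ∈p = there (here refl)
      ∈q : q ∈ S
      ∈q = there (there (here refl))
      ∈r : r ∈ S
      ∈r = there (there (there (here refl)))
      ∈y : y ∈ S
      ∈y = there (there (there (there (here refl))))
      sub : ∀ {a b c d e} → a ∈ S → b ∈ S → c ∈ S → d ∈ S → e ∈ S → ∀ {v} → v ∈ a ∷ b ∷ c ∷ d ∷ e ∷ [] → v ∈ S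
      sub a b c d e v∈ = All.lookup (a ∷ b ∷ c ∷ d ∷ e ∷ []) v∈
      distinct : ∀ {v a b c d : Fin n} → v ≢ a → v ≢ b → v ≢ c → v ≢ d → v ∉ a ∷ b ∷ c ∷ d ∷ []
      distinct a b c d v∈ = All.lookup (a ∷ b ∷ c ∷ d ∷ []) v∈ refl
      at-x : Fam (Rooted S x) 18
      at-x = k23-rooted {x} {y} {p ∷ q ∷ []} {y} {r}
        (cyc (xy ∷ yp ∷ pq ∷ last (adj-sym xq))
          ((x≢y ∷ x≢p ∷ x≢q ∷ []) ∷ (y≢p ∷ y≢q ∷ []) ∷ (p≢q ∷ []) ∷ [] ∷ []) 2≤3)
        refl (adj-sym ry) (λ _ v → v) (distinct (≢-sym x≢r) (≢-sym y≢r) (≢-sym p≢r) (≢-sym q≢r)) (sub ∈r ∈x ∈y ∈p ∈q)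
      rt : ∀ {z} → z ∈ S → Fam (Rooted S z) 18
      rt (here refl) = at-x
      rt (there (here refl)) = k23-rooted {p} {y} {r ∷ q ∷ []} {y} {x}
        (cyc (adj-sym yp ∷ adj-sym ry ∷ adj-sym qr ∷ last (adj-sym pq))
          ((≢-sym y≢p ∷ p≢r ∷ p≢q ∷ []) ∷ (y≢r ∷ y≢q ∷ []) ∷ (≢-sym q≢r ∷ []) ∷ [] ∷ []) 2≤3)
        refl (adj-sym xy) (λ _ v → v) (distinct x≢p x≢y x≢r x≢q) (sub ∈x ∈p ∈y ∈r ∈q)
      rt (there (there (here refl))) = k23-rooted {q} {r} {y ∷ p ∷ []} {q} {x}
        (cyc (qr ∷ ry ∷ yp ∷ last pq)
          ((q≢r ∷ ≢-sym y≢q ∷ ≢-sym p≢q ∷ []) ∷ (≢-sym y≢r ∷ ≢-sym p≢r ∷ []) ∷ (y≢p ∷ []) ∷ [] ∷ []) 2≤3)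
        refl (adj-sym xq) (λ v _ → v) (distinct x≢q x≢r x≢y x≢p) (sub ∈x ∈q ∈r ∈y ∈p)
      rt (there (there (there (here refl)))) = k23-rooted {r} {y} {p ∷ q ∷ []} {y} {x}
        (cyc (ry ∷ yp ∷ pq ∷ last qr)
          ((≢-sym y≢r ∷ ≢-sym p≢r ∷ ≢-sym q≢r ∷ []) ∷ (y≢p ∷ y≢q ∷ []) ∷ (p≢q ∷ []) ∷ [] ∷ []) 2≤3)
        refl (adj-sym xy) (λ _ v → v) (distinct x≢r x≢y x≢p x≢q) (sub ∈x ∈r ∈y ∈p ∈q)
      rt (there (there (there (there (here refl))))) = k23-rooted {y} {p} {q ∷ r ∷ []} {y} {x} C
        refl (adj-sym xy) (λ v _ → v) (distinct x≢y x≢p x≢q x≢r) (sub ∈x ∈y ∈p ∈q ∈r)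
      wh : Fam (Inner S) 35
      wh = Fam-⊎ {P = Inner (p ∷ q ∷ r ∷ y ∷ [])} {Q = Rooted S x}
        (λ (c , i) → c , (λ v → there (i v))) proj₁
        (λ (_ , i) (_ , kx) (_ , f) → x∉ (i (proj₁ f kx))) (whole g₄) at-x

    -- An ear landing at a neighbour of its start is closed the long way round, giving length at
    -- least 5. An ear landing at the opposite vertex does so only if it has two or more vertices
    -- outside; otherwise K₂,₃ appears.
    four-cycle : ∀ {y cs} → Cyc y cs → length cs ≡ 3 → Bound
    four-cycle {y} {cs} C eq with n ≤? 11
    -- Surplus 7 and deficit 21 alone reach n² + 1 for 5 ≤ n ≤ 11, with equality at 11; this
    -- explains the split.
    ... | yes n≤11 = inj₁ (+-cancelʳ-≤ 21 _ _ (≤-trans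
            (subst (λ i → i * i + 1 + 21 ≤ tri i + 7 * i) (toℕ-fromℕ< (s≤s n≤11))
              (check (fromℕ< (s≤s n≤11)) (subst (5 ≤_) (sym (toℕ-fromℕ< (s≤s n≤11))) 5≤n)))
            (subst (λ m → tri n + suc (tri m) * n ≤ k + suc (tri m) * m) eq
              (dense-bound (dense-cycle C) (∈-++⁺ʳ cs (here refl))))))
      where
      check : ∀ (i : Fin 12) → 5 ≤ toℕ i → toℕ i * toℕ i + 1 + 21 ≤ tri (toℕ i) + 7 * toℕ i
      check = toWitness {a? = all? λ i → (5 ≤? toℕ i) →-dec (toℕ i * toℕ i + 1 + 21 ≤? tri (toℕ i) + 7 * toℕ i)} tt
    ... | no n≰11
      with v , v∉ ← outside (y ∷ cs) (≤-trans (s≤s (s≤s (≤-reflexive eq))) 5≤n)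
      with a , b , a∈ , b∉ , e ← exit (here refl) v∉ (connected y v)
      with rotate C a∈
    ... | [] , cyc _ _ () , perm
    ... | p ∷ [] , cyc _ _ (s≤s ()) , perm
    ... | p ∷ q ∷ [] , C′ , perm = ⊥-elim (3≢4 (trans (↭-length perm) (cong suc eq)))
      where 3≢4 : 3 ≢ 4
            3≢4 ()
    ... | p ∷ q ∷ r ∷ s ∷ l , C′ , perm = long-cycle C′ (s≤s (s≤s (s≤s (s≤s z≤n))))
    ... | p ∷ q ∷ r ∷ [] , C′@(cyc (ap ∷ pq ∷ qr ∷ last ra) U@((a≢p ∷ a≢q ∷ a≢r ∷ []) ∷ (p≢q ∷ p≢r ∷ []) ∷ (q≢r ∷ []) ∷ [] ∷ []) _) , perm =
      go (sprout {B} (there (there (there (here refl)))) (λ b∈ → b∉ (∈-resp-↭ perm (cycle b∈))) e)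
      where
      B : List (Fin n)
      B = p ∷ q ∷ r ∷ a ∷ []
      cycle : ∀ {v} → v ∈ B → v ∈ a ∷ p ∷ q ∷ r ∷ []
      cycle = ∈-resp-↭ (++-comm (p ∷ q ∷ r ∷ []) (a ∷ []))
      go : Outcome B a → Bound
      go (tied C″ sep w∈ D) = second-cycle (inj₂ (refl , refl)) (D (dense-cycle C′)) C″ w∈ sep
      go (ear {x} {ws} c u av (here refl) w≢a xw) =
        long-cycle (ear-cycle c u av (adj-sym ra ∷ adj-sym qr ∷ adj-sym pq ∷ last (adj-sym xw))
            ((a≢r ∷ a≢q ∷ a≢p ∷ []) ∷ (≢-sym q≢r ∷ ≢-sym p≢r ∷ []) ∷ (≢-sym p≢q ∷ []) ∷ [] ∷ [])
            (λ v∈ → All.lookup {P = _∈ B} (there (there (there (here refl))) ∷ there (there (here refl)) ∷ there (here refl) ∷ here refl ∷ []) v∈))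
          (ear-length ws 4 (m≤n+m 4 (length ws)) refl)
      go (ear {x} {ws} c u av (there (there (here refl))) w≢a xw) =
        long-cycle (ear-cycle c u av (ap ∷ pq ∷ qr ∷ last (adj-sym xw)) U
            (λ v∈ → All.lookup {P = _∈ B} (there (there (there (here refl))) ∷ here refl ∷ there (here refl) ∷ there (there (here refl)) ∷ []) v∈))
          (ear-length ws 4 (m≤n+m 4 (length ws)) refl)
      go (ear c u av (there (there (there (here refl)))) w≢a xw) = ⊥-elim (w≢a refl)
      go (ear {ws = []} (last xa) u av (there (here refl)) w≢a xw) = k23 (≰⇒> n≰11) C′ (av (here refl)) xa xw
      go (ear {ws = ws@(_ ∷ ws′)} c u av (there (here refl)) w≢a xw) =
        long-cycle (ear-cycle c u av (ap ∷ pq ∷ last (adj-sym xw)) ((a≢p ∷ a≢q ∷ []) ∷ (p≢q ∷ []) ∷ [] ∷ [])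
            (λ v∈ → All.lookup {P = _∈ B} (there (there (there (here refl))) ∷ here refl ∷ there (here refl) ∷ []) v∈))
          (ear-length ws 3 (s≤s (m≤n+m 3 (length ws′))) refl)

    -- An ear on a triangle can always be closed through all three vertices, so it yields a cycle of
    -- length at least 4 and the earlier cases apply.
    triangle : ∀ {y cs} → Cyc y cs → length cs ≡ 2 → Bound
    triangle {y} {cs} C eq
      with v , v∉ ← outside (y ∷ cs) (≤-trans (s≤s (s≤s (≤-reflexive eq))) (≤-trans (n≤1+n 4) 5≤n))
      with a , b , a∈ , b∉ , e ← exit (here refl) v∉ (connected y v)
      with rotate C a∈
    ... | [] , cyc _ _ () , perm
    ... | p ∷ [] , cyc _ _ (s≤s ()) , perm
    ... | p ∷ q ∷ r ∷ l , C′ , perm = ⊥-elim (3≢4 (suc-injective (suc-injective (suc-injective (trans (↭-length perm) (cong suc eq))))))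
      where 3≢4 : ∀ {m} → suc m ≢ 0
            3≢4 ()
    ... | p ∷ q ∷ [] , C′@(cyc (ap ∷ pq ∷ last qa) U@((a≢p ∷ a≢q ∷ []) ∷ (p≢q ∷ []) ∷ [] ∷ []) _) , perm =
      go (sprout {B} (there (there (here refl))) (λ b∈ → b∉ (∈-resp-↭ perm (cycle b∈))) e)
      where
      B : List (Fin n)
      B = p ∷ q ∷ a ∷ []
      cycle : ∀ {v} → v ∈ B → v ∈ a ∷ p ∷ q ∷ []
      cycle = ∈-resp-↭ (++-comm (p ∷ q ∷ []) (a ∷ []))
      longer : ∀ {x} ws {l} → Cyc x (ws ++ l) → length l ≡ 3 → Bound
      longer []        C eq = four-cycle C eq
      longer (w ∷ ws) {l} C eq = long-cycle C (s≤s (subst (3 ≤_) (sym (length-++ ws)) (≤-trans (≤-reflexive (sym eq)) (m≤n+m (length l) (length ws)))))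
      go : Outcome B a → Bound
      go (tied C″ sep w∈ D) = second-cycle (inj₁ (refl , refl)) (D (dense-cycle C′)) C″ w∈ sep
      go (ear {ws = ws} c u av (here refl) w≢a xw) =
        longer ws (ear-cycle c u av (adj-sym qa ∷ adj-sym pq ∷ last (adj-sym xw))
          ((a≢q ∷ a≢p ∷ []) ∷ (≢-sym p≢q ∷ []) ∷ [] ∷ [])
          (λ v∈ → All.lookup {P = _∈ B} (there (there (here refl)) ∷ there (here refl) ∷ here refl ∷ []) v∈)) refl
      go (ear {ws = ws} c u av (there (here refl)) w≢a xw) =
        longer ws (ear-cycle c u av (ap ∷ pq ∷ last (adj-sym xw)) U
          (λ v∈ → All.lookup {P = _∈ B} (there (there (here refl)) ∷ here refl ∷ there (here refl) ∷ []) v∈)) refl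
      go (ear c u av (there (there (here refl))) w≢a xw) = ⊥-elim (w≢a refl)

    any-cycle : ∀ {y cs} → Cyc y cs → Bound
    any-cycle {cs = _ ∷ []} (cyc _ _ (s≤s ()))
    any-cycle {cs = _ ∷ _ ∷ []} C = triangle C refl
    any-cycle {cs = _ ∷ _ ∷ _ ∷ []} C = four-cycle C refl
    any-cycle {cs = _ ∷ _ ∷ _ ∷ _ ∷ _} C = long-cycle C (s≤s (s≤s (s≤s (s≤s z≤n))))

    -- The search starts from a single vertex, where no ear is possible: it would have to land at a
    -- second vertex of the set. Hence a cycle is found.
    lower-bound : Bound
    lower-bound with y ← fromℕ< {0} {n} (≤-trans (s≤s z≤n) 5≤n)
      with v , v∉ ← outside (y ∷ []) (≤-trans (s≤s (s≤s z≤n)) 5≤n)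
      with exit (here refl) v∉ (connected y v)
    ... | a , b , here refl , b∉ , e with sprout (here refl) b∉ e
    ... | tied C _ _ _ = any-cycle C
    ... | ear c u av (here refl) w≢a _ = ⊥-elim (w≢a refl)

-- Passage to the encoding of the core index, and covers as upper bounds.

T-ext : ∀ {a b} → (T a → T b) → (T b → T a) → a ≡ b
T-ext {false} {false} f g = refl
T-ext {false} {true}  f g = ⊥-elim (g tt)
T-ext {true}  {false} f g = ⊥-elim (f tt)
T-ext {true}  {true}  f g = refl

vec-ext : ∀ {A : Set} {n} {xs ys : Vec A n} → (∀ i → Vec.lookup xs i ≡ Vec.lookup ys i) → xs ≡ ys
vec-ext {xs = xs} {ys} f = trans (sym (tabulate∘lookup xs)) (trans (tabulate-cong f) (tabulate∘lookup ys))

module _ {n : ℕ} where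

  decode : Subset.Subset n × EdgeSet n → Sub n
  decode (V , E) = record
    { V  = λ v → T (Vec.lookup V v) ; E  = λ u v → T (edgeRel E u v)
    ; V? = λ v → T? _               ; E? = λ u v → T? _ }

  encode : Sub n → Subset.Subset n × EdgeSet n
  encode H = tabulate (λ v → ⌊ V? H v ⌋) , tabulate (λ u → tabulate (λ v → ⌊ E? H u v ⌋))

  decode-encode : ∀ H → decode (encode H) ≈ H
  decode-encode H =
    ((λ {v} p → toWitness (subst T (lookup∘tabulate _ v) p)) , (λ {u} {v} p → toWitness (subst T (edge u v) p))) ,
    ((λ {v} p → subst T (sym (lookup∘tabulate _ v)) (fromWitness p)) , (λ {u} {v} p → subst T (sym (edge u v)) (fromWitness p)))
    where
    edge : ∀ u v → edgeRel (proj₂ (encode H)) u v ≡ ⌊ E? H u v ⌋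
    edge u v = trans (cong (λ r → Vec.lookup r v) (lookup∘tabulate _ u)) (lookup∘tabulate _ v)

  decode-injective : ∀ {X Y} → decode X ≈ decode Y → X ≡ Y
  decode-injective ((f , g) , (f′ , g′)) =
    cong₂ _,_ (vec-ext (λ v → T-ext f f′)) (vec-ext (λ u → vec-ext (λ v → T-ext g g′)))

  ∈⇒T : ∀ {V : Subset.Subset n} {v} → v Subset.∈ V → T (Vec.lookup V v)
  ∈⇒T p = Equivalence.from T-≡ ([]=⇒lookup p)

  T⇒∈ : ∀ {V : Subset.Subset n} {v} → T (Vec.lookup V v) → v Subset.∈ V
  T⇒∈ p = lookup⇒[]= _ _ (Equivalence.to T-≡ p)

  module _ {G : Graph n} where

    Conn-≈ : ∀ {H K} → H ≈ K → Conn G H → Conn G K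
    Conn-≈ ((f , g) , (f′ , g′)) c = record
      { ne   = proj₁ (ne c) , f (proj₂ (ne c))
      ; symm = λ e → g (symm c (g′ e)) ; adj = λ e → adj c (g′ e) ; end = λ e → f (end c (g′ e))
      ; conn = λ p q → map g (conn c (f′ p) (f′ q)) }

    IsConnSub⇒Conn : ∀ {V E} → IsConnSub G V E → Conn G (decode (V , E))
    IsConnSub⇒Conn {V} {E} c = record
      { ne   = proj₁ nonempty , ∈⇒T (proj₂ nonempty)
      ; symm = λ {u} {v} → subst T (symmetric u v)
      ; adj  = subEdges _ _
      ; end  = λ e → ∈⇒T (proj₁ (endpoints _ _ e))
      ; conn = λ p q → star (connected _ _ (T⇒∈ p) (T⇒∈ q)) }
      where
      open IsConnSub c
      star : ∀ {u v} → Walk (edgeRel E) u v → Star (λ u v → T (edgeRel E u v)) u v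
      star here       = ε
      star (step e w) = e ◅ star w

    Conn⇒IsConnSub : ∀ {V E} → Conn G (decode (V , E)) → IsConnSub G V E
    Conn⇒IsConnSub {V} {E} c = record
      { nonempty  = proj₁ (ne c) , T⇒∈ (proj₂ (ne c))
      ; symmetric = λ u v → T-ext (symm c) (symm c)
      ; subEdges  = λ u v → adj c
      ; endpoints = λ u v e → T⇒∈ (end c e) , T⇒∈ (end c (symm c e))
      ; connected = λ u v p q → walk (conn c (∈⇒T p) (∈⇒T q)) }
      where
      walk : ∀ {u v} → Star (λ u v → T (edgeRel E u v)) u v → Walk (edgeRel E) u v
      walk ε       = here
      walk (e ◅ s) = step e (walk s)

    Fam-≤-index : ∀ {m k} → CoreIndex G k → Fam (Conn G) m → m ≤ k
    Fam-≤-index (L , refl , _ , _ , complete) F = injective⇒≤ {f = λ i → index (mem i)} injective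
      where
      code : ∀ i → _
      code i = encode (at F i)
      mem : ∀ i → code i ∈ L
      mem i = complete _ _ (Conn⇒IsConnSub (Conn-≈ {at F i} {decode (code i)}
        (≈-sym {H = decode (code i)} {at F i} (decode-encode (at F i))) (ok F i)))
      injective : ∀ {i j} → index (mem i) ≡ index (mem j) → i ≡ j
      injective {i} {j} eq = inj F (≈-trans {H = at F i} {decode (code i)} {at F j}
        (≈-sym {H = decode (code i)} {at F i} (decode-encode (at F i)))
        (subst (λ X → decode X ≈ at F j) (sym same) (decode-encode (at F j))))
        where
        same : code i ≡ code j
        same = trans (lookup-index (mem i)) (trans (cong (lookup L) eq) (sym (lookup-index (mem j))))

  Cover : (Sub n → Set) → ℕ → Set₁
  Cover P m = Σ (Fin m → Sub n) λ f → ∀ {H} → P H → ∃ λ i → H ≈ f i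

  index-≤-Cover : ∀ {G m k} → CoreIndex G m → Cover (Conn G) k → m ≤ k
  index-≤-Cover {G} (L , refl , unique , sound , _) (f , c) = injective⇒≤ {f = λ i → proj₁ (hit i)} injective
    where
    hit : ∀ i → ∃ λ j → decode (lookup L i) ≈ f j
    hit i = c (IsConnSub⇒Conn (sound _ _ (∈-lookup i)))
    injective : ∀ {i j} → proj₁ (hit i) ≡ proj₁ (hit j) → i ≡ j
    injective {i} {j} eq = unique-lookup unique (decode-injective
      (≈-trans {H = decode (lookup L i)} {f (proj₁ (hit i))} {decode (lookup L j)} (proj₂ (hit i))
        (≈-sym {H = decode (lookup L j)} {f (proj₁ (hit i))}
          (subst (λ a → decode (lookup L j) ≈ f a) (sym eq) (proj₂ (hit j))))))

  Cover-⊆ : ∀ {P Q : Sub n → Set} {m} → (∀ {H} → P H → Q H) → Cover Q m → Cover P m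
  Cover-⊆ p (f , c) = f , λ x → c (p x)

  Cover-one : ∀ {P : Sub n → Set} K → (∀ {H} → P H → H ≈ K) → Cover P 1
  Cover-one K p = (λ _ → K) , λ h → zero , p h

  Cover-⊎ : ∀ {P Q R : Sub n → Set} {m k} → (∀ {H} → P H → Q H ⊎ R H) → Cover Q m → Cover R k → Cover P (m + k)
  Cover-⊎ {P} {m = m} {k} split (f , c) (f′ , c′) = g , λ {H} p → find {H} (split p)
    where
    g : Fin (m + k) → Sub n
    g i = [ f , f′ ]′ (splitAt m i)
    find : ∀ {H} → _ ⊎ _ → ∃ λ i → H ≈ g i
    find {H} (inj₁ q) with i , eq ← c q =
      i ↑ˡ k , subst (λ s → H ≈ [ f , f′ ]′ s) (sym (splitAt-↑ˡ m i k)) eq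
    find {H} (inj₂ r) with i , eq ← c′ r =
      m ↑ʳ i , subst (λ s → H ≈ [ f , f′ ]′ s) (sym (splitAt-↑ʳ m k i)) eq

  ∪-cong : ∀ {H K H′ K′ : Sub n} → H ≈ H′ → K ≈ K′ → H ∪ K ≈ H′ ∪ K′
  ∪-cong {H} {K} {H′} {K′} (p , p′) (q , q′) = mono {H} {K} {H′} {K′} p q , mono {H′} {K′} {H} {K} p′ q′
    where
    mono : ∀ {H K H′ K′ : Sub n} → H ≲ H′ → K ≲ K′ → H ∪ K ≲ H′ ∪ K′
    mono (f , g) (f′ , g′) =
      (λ { (inj₁ x) → inj₁ (f x) ; (inj₂ x) → inj₂ (f′ x) }) ,
      (λ { (inj₁ x) → inj₁ (g x) ; (inj₂ x) → inj₂ (g′ x) })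

  Cover-∪ : ∀ {P Q R : Sub n → Set} {m k} →
    (∀ {H} → P H → Σ (Sub n) λ K → Σ (Sub n) λ L → Q K × R L × H ≈ K ∪ L) →
    Cover Q m → Cover R k → Cover P (m * k)
  Cover-∪ {P} {m = m} {k} split (f , c) (f′ , c′) = g , find
    where
    pair : Fin m × Fin k → Sub n
    pair (i , j) = f i ∪ f′ j
    g : Fin (m * k) → Sub n
    g i = pair (remQuot {m} k i)
    find : ∀ {H} → P H → ∃ λ i → H ≈ g i
    find {H} p with K , L , q , r , eq ← split p with i , qi ← c q | j , rj ← c′ r =
      combine i j , subst (λ s → H ≈ pair s) (sym (remQuot-combine i j))
        (≈-trans {H = H} {K ∪ L} {f i ∪ f′ j} eq (∪-cong {K} {L} {f i} {f′ j} qi rj))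

-- Upper bound for the cycle.

module CycleUpper (m : ℕ) where

  n : ℕ
  n = suc m

  prv : Fin n → Fin n
  prv zero    = fromℕ m
  prv (suc i) = inject₁ i

  prv-injective : ∀ {a b} → prv a ≡ prv b → a ≡ b
  prv-injective {zero}  {zero}  eq = refl
  prv-injective {zero}  {suc b} eq = ⊥-elim (fromℕ≢inject₁ eq)
  prv-injective {suc a} {zero}  eq = ⊥-elim (fromℕ≢inject₁ (sym eq))
  prv-injective {suc a} {suc b} eq = cong suc (inject₁-injective eq)

  cycle-forward : ∀ u v → T (cycleℕ n (toℕ u) (toℕ v)) → u ≡ prv v
  cycle-forward u v t with Equivalence.to (T-∨ {suc (toℕ u) ℕ.≡ᵇ toℕ v}) t
  cycle-forward u (suc i) _ | inj₁ p = toℕ-injective (trans (suc-injective (≡ᵇ⇒≡ _ _ p)) (sym (toℕ-inject₁ i)))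
  cycle-forward u v       _ | inj₂ p with q , r ← Equivalence.to (T-∧ {suc (toℕ u) ℕ.≡ᵇ n}) p
    with v | ≡ᵇ⇒≡ (toℕ v) 0 r
  ... | zero | _ = toℕ-injective (trans (suc-injective (≡ᵇ⇒≡ _ _ q)) (sym (toℕ-fromℕ m)))

  cycle-adj : ∀ u v → T (Cycle n u v) → u ≡ prv v ⊎ v ≡ prv u
  cycle-adj u v t with Equivalence.to T-∨ t
  ... | inj₁ p = inj₁ (cycle-forward u v p)
  ... | inj₂ p = inj₂ (cycle-forward v u p)

  iter : ℕ → Fin n → Fin n
  iter zero    u = u
  iter (suc k) u = iter k (prv u)

  iter-suc : ∀ k u → iter (suc k) u ≡ prv (iter k u)
  iter-suc zero    u = refl
  iter-suc (suc k) u = iter-suc k (prv u)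

  iter-injective : ∀ k {u v} → iter k u ≡ iter k v → u ≡ v
  iter-injective zero    eq = eq
  iter-injective (suc k) eq = prv-injective (iter-injective k eq)

  iter-+ : ∀ d k u → iter (d + k) u ≡ iter k (iter d u)
  iter-+ zero    k u = refl
  iter-+ (suc d) k u = iter-+ d k (prv u)

  -- Two of the first n + 1 iterates coincide, and injectivity cancels the common initial part.
  iter-return : ∀ u → ∃ λ d → d < n × iter (suc d) u ≡ u
  iter-return u with i , j , i<j , eq ← pigeonhole {n} {suc n} ≤-refl (λ i → iter (toℕ i) u)
    with d , e ← m≤n⇒∃[o]m+o≡n i<j =
    d , ≤-trans (s≤s (m≤n+m d (toℕ i))) (≤-trans (≤-reflexive e) (≤-pred (toℕ<n j))) ,
    sym (iter-injective (toℕ i) (trans eq (trans (cong (λ a → iter a u) (trans (sym e) (cong suc (+-comm (toℕ i) d))))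
      (iter-+ (suc d) (toℕ i) u))))

  arc : Fin n → ℕ → Sub n
  arc u zero    = pt u
  arc u (suc k) = ed u (prv u) ∪ arc (prv u) k

  arc-start : ∀ u k → V (arc u k) u
  arc-start u zero    = refl
  arc-start u (suc k) = inj₁ (inj₁ refl)

  arc-last : ∀ u k {a} → V (arc u k) a → a ≡ iter k u ⊎ E (arc u k) a (prv a)
  arc-last u zero    p = inj₁ p
  arc-last u (suc k) (inj₁ (inj₁ refl)) = inj₂ (inj₁ (inj₁ (refl , refl)))
  arc-last u (suc k) (inj₁ (inj₂ refl)) with arc-last (prv u) k (arc-start (prv u) k)
  ... | inj₁ p = inj₁ p
  ... | inj₂ p = inj₂ (inj₂ p)
  arc-last u (suc k) (inj₂ p) with arc-last (prv u) k p
  ... | inj₁ q = inj₁ q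
  ... | inj₂ q = inj₂ (inj₂ q)

  arc-first : ∀ u k {a} → V (arc u k) a → a ≡ u ⊎ ∃ λ b → a ≡ prv b × E (arc u k) a b
  arc-first u zero    p = inj₁ p
  arc-first u (suc k) (inj₁ (inj₁ refl)) = inj₁ refl
  arc-first u (suc k) (inj₁ (inj₂ refl)) = inj₂ (u , refl , inj₁ (inj₂ (refl , refl)))
  arc-first u (suc k) (inj₂ p) with arc-first (prv u) k p
  ... | inj₁ refl = inj₂ (u , refl , inj₁ (inj₂ (refl , refl)))
  ... | inj₂ (b , q , e) = inj₂ (b , q , inj₂ e)

  arc-end : ∀ u k {a b} → E (arc u k) a b → V (arc u k) b
  arc-end u (suc k) (inj₁ (inj₁ (_ , refl))) = inj₁ (inj₂ refl)
  arc-end u (suc k) (inj₁ (inj₂ (_ , refl))) = inj₁ (inj₁ refl)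
  arc-end u (suc k) (inj₂ e) = inj₂ (arc-end (prv u) k e)

  full : Sub n
  full = record
    { V = λ _ → ⊤ ; E = λ u v → T (Cycle n u v) ; V? = λ _ → yes tt ; E? = λ _ _ → T? _ }

  module _ {H : Sub n} (c : Conn (Cycle n) H) where

    -- An open end of H: a vertex prv w whose cycle edge to w is missing.
    module _ {w : Fin n} (hw : V H (prv w)) (¬e : ¬ E H w (prv w)) where

      u : Fin n
      u = prv w

      Step : Fin n → Set
      Step i = E H (iter (toℕ i) u) (iter (suc (toℕ i)) u)

      -- Going once round from `u` returns to `u` through `w`, along the edge assumed missing.
      ¬all : ¬ (∀ i → Step i)
      ¬all all with d , d<n , eq ← iter-return u =
        ¬e (subst (λ x → E H x u) back (subst (E H (iter d u)) eq
          (subst (λ i → E H (iter i u) (iter (suc i) u)) (toℕ-fromℕ< d<n) (all (fromℕ< d<n)))))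
        where
        back : iter d u ≡ w
        back = prv-injective (trans (sym (iter-suc d u)) eq)

      arc-≲ : ∀ u k → V H u → (∀ j → j < k → E H (iter j u) (iter (suc j) u)) → arc u k ≲ H
      arc-≲ u zero    hu _  = (λ { refl → hu }) , λ ()
      arc-≲ u (suc k) hu es with f , g ← arc-≲ (prv u) k (end c (symm c (es 0 (s≤s z≤n)))) (λ j j<k → es (suc j) (s≤s j<k)) =
        (λ { (inj₁ (inj₁ refl)) → hu ; (inj₁ (inj₂ refl)) → end c (symm c (es 0 (s≤s z≤n))) ; (inj₂ x) → f x }) ,
        (λ { (inj₁ (inj₁ (refl , refl))) → es 0 (s≤s z≤n) ; (inj₁ (inj₂ (refl , refl))) → symm c (es 0 (s≤s z≤n)) ; (inj₂ x) → g x })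

      -- `k` is the first step whose edge is missing. Beyond either end of the arc the cycle edge is
      -- absent from `H`, so no walk in `H` leaves the arc.
      is-arc : ∃ λ (k : Fin n) → H ≈ arc u (toℕ k)
      is-arc with k , ¬s , ss ← ¬∀⟶∃¬-smallest n Step (λ i → E? H _ _) ¬all =
        k , ((λ hv → stay (arc-start u (toℕ k)) (conn c hw hv)) , (λ e → edge (stay (arc-start u (toℕ k)) (conn c hw (end c e))) e)) ,
        arc-≲ u (toℕ k) hw (λ j j<k → subst (λ i → E H (iter i u) (iter (suc i) u))
          (trans (toℕ-inject (fromℕ< j<k)) (toℕ-fromℕ< j<k)) (ss (fromℕ< j<k)))
        where
        A : Sub n
        A = arc u (toℕ k)
        edge : ∀ {a b} → V A a → E H a b → E A a b
        edge {a} {b} va e with cycle-adj a b (adj c e)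
        ... | inj₂ refl with arc-last u (toℕ k) va
        ...   | inj₂ e′ = e′
        ...   | inj₁ refl = ⊥-elim (¬s (subst (E H a) (sym (iter-suc (toℕ k) u)) e))
        edge {a} {b} va e | inj₁ refl with arc-first u (toℕ k) va
        ...   | inj₁ eq with refl ← prv-injective {b} {w} eq = ⊥-elim (¬e (symm c e))
        ...   | inj₂ (b′ , eq , e′) with refl ← prv-injective {b} {b′} eq = e′
        stay : ∀ {a b} → V A a → Star (E H) a b → V A b
        stay va ε       = va
        stay va (e ◅ s) = stay (arc-end u (toℕ k) (edge va e)) s

    -- Without an open end, membership spreads from any vertex to its cyclic successor: up to the
    -- top, across to 0, and up again.
    is-full : (∀ w → V H (prv w) → E H w (prv w)) → H ≈ full
    is-full closed = ((λ _ → tt) , adj c) , ((λ {v} _ → every v) , back)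
      where
      up : ∀ w → V H (prv w) → V H w
      up w p = end c (closed w p)
      top : V H (fromℕ m)
      top = >-weakInduction (λ i → V H i → V H (fromℕ m)) (λ x → x) (λ i f x → f (up (suc i) x)) _ (proj₂ (ne c))
      every : ∀ v → V H v
      every = <-weakInduction (V H) (up zero top) (λ i → up (suc i))
      back : ∀ {u v} → T (Cycle n u v) → E H u v
      back {u} {v} t with cycle-adj u v t
      ... | inj₁ refl = symm c (closed v (every _))
      ... | inj₂ refl = closed u (every _)

  -- There are `n` starts and `n` possible edge counts 0 to n - 1, and one whole cycle.
  cycle-cover : Cover (Conn (Cycle n)) (n * n + 1)
  cycle-cover = Cover-⊎ {Q = λ H → Σ (Fin n × Fin n) λ (u , k) → H ≈ arc u (toℕ k)} {R = λ H → H ≈ full} split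
    ((λ i → let (u , k) = remQuot {n} n i in arc u (toℕ k)) ,
     (λ {H} ((u , k) , eq) → combine u k , subst (λ (u , k) → H ≈ arc u (toℕ k)) (sym (remQuot-combine u k)) eq))
    (Cover-one full (λ x → x))
    where
    split : ∀ {H} → Conn (Cycle n) H → (Σ (Fin n × Fin n) λ (u , k) → H ≈ arc u (toℕ k)) ⊎ H ≈ full
    split {H} c with any? (λ w → V? H (prv w) ×-dec ¬? (E? H w (prv w)))
    ... | yes (w , hw , ¬e) = let (k , eq) = is-arc {H} c hw ¬e in inj₁ ((prv w , k) , eq)
    ... | no none = inj₂ (is-full {H} c closed)
      where
      closed : ∀ w → V H (prv w) → E H w (prv w)
      closed w hw with E? H w (prv w)
      ... | yes e = e
      ... | no ¬e = ⊥-elim (none (w , hw , ¬e))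

-- Cutting subgraphs at a vertex, and the subgraphs of a triangle.

module _ {n : ℕ} where

  restrict : {X : Fin n → Set} → (∀ v → Dec (X v)) → Sub n → Sub n
  restrict {X} X? H = record
    { V  = λ v → V H v × X v
    ; E  = λ u v → E H u v × X u × X v
    ; V? = λ v → V? H v ×-dec X? v
    ; E? = λ u v → E? H u v ×-dec (X? u ×-dec X? v) }

  -- A walk to `r` is followed until it first leaves `X`; by the boundary condition it is then
  -- already at `r`.
  restrict-conn : ∀ {G H r} {X : Fin n → Set} (X? : ∀ v → Dec (X v)) → Conn G H → V H r → X r →
    (∀ {u v} → E H u v → X u → ¬ X v → u ≡ r) → Conn G (restrict X? H)
  restrict-conn {G} {H} {r} {X} X? c hr xr boundary = record
    { ne   = r , hr , xr
    ; symm = λ (e , xu , xv) → symm c e , xv , xu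
    ; adj  = λ (e , _) → adj c e
    ; end  = λ (e , xu , _) → end c e , xu
    ; conn = λ (hu , xu) (hv , xv) →
        to-root xu (conn c hu hr) ◅◅ reverse (λ (e , xu , xv) → symm c e , xv , xu) (to-root xv (conn c hv hr)) }
    where
    to-root : ∀ {u} → X u → Star (E H) u r → Star (E (restrict X? H)) u r
    to-root xu ε = ε
    to-root xu (_◅_ {j = v} e s) with X? v
    ... | yes xv = (e , xu , xv) ◅ to-root xv s
    ... | no ¬xv with refl ← boundary e xu ¬xv = ε

  restrict-∪ : ∀ {H} {X Y : Fin n → Set} (X? : ∀ v → Dec (X v)) (Y? : ∀ v → Dec (Y v)) →
    (∀ {v} → V H v → X v ⊎ Y v) → (∀ {u v} → E H u v → (X u × X v) ⊎ (Y u × Y v)) →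
    H ≈ restrict X? H ∪ restrict Y? H
  restrict-∪ {H} {X} {Y} X? Y? f g =
    ((λ h → tag h (f h)) , (λ e → etag e (g e))) ,
    ((λ { (inj₁ (h , _)) → h ; (inj₂ (h , _)) → h }) , (λ { (inj₁ (e , _)) → e ; (inj₂ (e , _)) → e }))
    where
    tag : ∀ {v} → V H v → X v ⊎ Y v → (V H v × X v) ⊎ (V H v × Y v)
    tag h (inj₁ x) = inj₁ (h , x)
    tag h (inj₂ x) = inj₂ (h , x)
    etag : ∀ {u v} → E H u v → (X u × X v) ⊎ (Y u × Y v) → (E H u v × X u × X v) ⊎ (E H u v × Y u × Y v)
    etag h (inj₁ x) = inj₁ (h , x)
    etag h (inj₂ x) = inj₂ (h , x)

  isolated : ∀ {G} {H : Sub n} {c} → Conn G H → V H c → (∀ {x} → ¬ E H c x) → H ≈ pt c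
  isolated {G} {H} {c} C hc none =
    ((λ hv → alone (conn C hc hv)) , (λ e → none (subst (λ u → E H u _) (alone (conn C hc (end C e))) e))) ,
    ((λ { refl → hc }) , λ ())
    where
    alone : ∀ {v} → Star (E H) c v → v ≡ c
    alone ε       = refl
    alone (e ◅ _) = ⊥-elim (none e)

  Within₂ : Graph n → Fin n → Fin n → Sub n → Set
  Within₂ G a b H = Conn G H × (∀ {v} → V H v → v ≡ a ⊎ v ≡ b)

  Within₃ : Graph n → Fin n → Fin n → Fin n → Sub n → Set
  Within₃ G r a b H = Conn G H × V H r × (∀ {v} → V H v → v ≡ r ⊎ v ≡ a ⊎ v ≡ b)

  module _ {G : Graph n} (irrefl : ∀ u → ¬ T (G u u)) where

    no-loop : ∀ {H u} → Conn G H → ¬ E H u u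
    no-loop c e = irrefl _ (adj c e)

    pair-cover : ∀ a b → Cover (Within₂ G a b) 3
    pair-cover a b = Cover-⊎ {Q = λ H → H ≈ pt a} {R = λ H → (H ≈ pt b) ⊎ (H ≈ ed a b)} split
      (Cover-one (pt a) (λ x → x))
      (Cover-⊎ {Q = λ H → H ≈ pt b} {R = λ H → H ≈ ed a b} (λ x → x)
        (Cover-one (pt b) (λ x → x)) (Cover-one (ed a b) (λ x → x)))
      where
      split : ∀ {H} → Within₂ G a b H → (H ≈ pt a) ⊎ ((H ≈ pt b) ⊎ (H ≈ ed a b))
      split {H} (c , w) with E? H a b
      ... | yes e = inj₂ (inj₂ ((w , edge) ,
              ((λ { (inj₁ refl) → end c e ; (inj₂ refl) → end c (symm c e) }) ,
               (λ { (inj₁ (refl , refl)) → e ; (inj₂ (refl , refl)) → symm c e }))))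
        where
        edge : ∀ {u v} → E H u v → (u ≡ a × v ≡ b) ⊎ (u ≡ b × v ≡ a)
        edge f with w (end c f) | w (end c (symm c f))
        ... | inj₁ refl | inj₁ refl = ⊥-elim (no-loop {H} c f)
        ... | inj₁ refl | inj₂ refl = inj₁ (refl , refl)
        ... | inj₂ refl | inj₁ refl = inj₂ (refl , refl)
        ... | inj₂ refl | inj₂ refl = ⊥-elim (no-loop {H} c f)
      ... | no ¬e with ne c
      ...   | v , hv with w hv
      ...     | inj₁ refl = inj₁ (isolated {G} {H} c hv none)
        where
        none : ∀ {x} → ¬ E H a x
        none f with w (end c (symm c f))
        ... | inj₁ refl = no-loop {H} c f
        ... | inj₂ refl = ¬e f
      ...     | inj₂ refl = inj₂ (inj₁ (isolated {G} {H} c hv none))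
        where
        none : ∀ {x} → ¬ E H b x
        none f with w (end c (symm c f))
        ... | inj₁ refl = ¬e (symm c f)
        ... | inj₂ refl = no-loop {H} c f

    module Triangle (r a b : Fin n) (r≢a : r ≢ a) where

      -- An absent edge contributes the point `r`, which lies in the subgraph in any case, so one
      -- formula covers all patterns.
      opt : Bool → Fin n → Fin n → Sub n
      opt x u v = if x then ed u v else pt r

      pattern-of : Bool × Bool × Bool → Sub n
      pattern-of (x , y , z) = opt x r a ∪ opt y r b ∪ opt z a b

      -- Every edge set on the triangle except {ab} alone.
      table : Fin 7 → Bool × Bool × Bool
      table zero = false , false , false
      table (suc zero) = false , true , false
      table (suc (suc zero)) = false , true , true
      table (suc (suc (suc zero))) = true , false , false
      table (suc (suc (suc (suc zero)))) = true , false , true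
      table (suc (suc (suc (suc (suc zero))))) = true , true , false
      table (suc (suc (suc (suc (suc (suc zero)))))) = true , true , true

      table-onto : ∀ x y z → (T z → T x ⊎ T y) → ∃ λ i → table i ≡ (x , y , z)
      table-onto false false false _ = zero , refl
      table-onto false false true  h with h tt
      ... | inj₁ ()
      ... | inj₂ ()
      table-onto false true  false _ = suc zero , refl
      table-onto false true  true  _ = suc (suc zero) , refl
      table-onto true  false false _ = suc (suc (suc zero)) , refl
      table-onto true  false true  _ = suc (suc (suc (suc zero))) , refl
      table-onto true  true  false _ = suc (suc (suc (suc (suc zero)))) , refl
      table-onto true  true  true  _ = suc (suc (suc (suc (suc (suc zero))))) , refl

      module Shape {H : Sub n} (w : Within₃ G r a b H) where

        c : Conn G H
        c = proj₁ w

        hr : V H r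
        hr = proj₁ (proj₂ w)

        in₃ : ∀ {v} → V H v → v ≡ r ⊎ v ≡ a ⊎ v ≡ b
        in₃ = proj₂ (proj₂ w)

        opt-⊇ : ∀ {u v} (d : Dec (E H u v)) → E H u v → ed u v ≲ opt (does d) u v
        opt-⊇ (yes _) e = (λ x → x) , (λ x → x)
        opt-⊇ (no ¬e) e = ⊥-elim (¬e e)

        opt-⊆ : ∀ {u v} (d : Dec (E H u v)) → opt (does d) u v ≲ H
        opt-⊆ (yes e) = (λ { (inj₁ refl) → end c e ; (inj₂ refl) → end c (symm c e) }) ,
                        (λ { (inj₁ (refl , refl)) → e ; (inj₂ (refl , refl)) → symm c e })
        opt-⊆ (no _)  = (λ { refl → hr }) , λ ()

        opt-end : ∀ x {u v p q} → E (opt x u v) p q → V (opt x u v) p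
        opt-end true (inj₁ (p , _)) = inj₁ p
        opt-end true (inj₂ (p , _)) = inj₂ p

        opt-root : ∀ x {v} → V (opt x r v) r
        opt-root true  = inj₁ refl
        opt-root false = refl

        x y z : Bool
        x = does (E? H r a)
        y = does (E? H r b)
        z = does (E? H a b)

        K : Sub n
        K = pattern-of (x , y , z)

        edge : ∀ {u v} → E H u v → E K u v
        edge {u} {v} e with in₃ (end c e) | in₃ (end c (symm c e))
        ... | inj₁ refl | inj₁ refl = ⊥-elim (no-loop {H} c e)
        ... | inj₁ refl | inj₂ (inj₁ refl) = inj₁ (proj₂ (opt-⊇ (E? H r a) e) (inj₁ (refl , refl)))
        ... | inj₁ refl | inj₂ (inj₂ refl) = inj₂ (inj₁ (proj₂ (opt-⊇ (E? H r b) e) (inj₁ (refl , refl))))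
        ... | inj₂ (inj₁ refl) | inj₁ refl = inj₁ (proj₂ (opt-⊇ (E? H r a) (symm c e)) (inj₂ (refl , refl)))
        ... | inj₂ (inj₂ refl) | inj₁ refl = inj₂ (inj₁ (proj₂ (opt-⊇ (E? H r b) (symm c e)) (inj₂ (refl , refl))))
        ... | inj₂ (inj₁ refl) | inj₂ (inj₁ refl) = ⊥-elim (no-loop {H} c e)
        ... | inj₂ (inj₂ refl) | inj₂ (inj₂ refl) = ⊥-elim (no-loop {H} c e)
        ... | inj₂ (inj₁ refl) | inj₂ (inj₂ refl) = inj₂ (inj₂ (proj₂ (opt-⊇ (E? H a b) e) (inj₁ (refl , refl))))
        ... | inj₂ (inj₂ refl) | inj₂ (inj₁ refl) = inj₂ (inj₂ (proj₂ (opt-⊇ (E? H a b) (symm c e)) (inj₂ (refl , refl))))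

        K-end : ∀ {u v} → E K u v → V K u
        K-end (inj₁ e)        = inj₁ (opt-end x e)
        K-end (inj₂ (inj₁ e)) = inj₂ (inj₁ (opt-end y e))
        K-end (inj₂ (inj₂ e)) = inj₂ (inj₂ (opt-end z e))

        vertex : ∀ {v} → V H v → V K v
        vertex {v} hv with v ≟ r
        ... | yes refl = inj₁ (opt-root x)
        ... | no v≢r with conn c hv hr
        ...   | ε = ⊥-elim (v≢r refl)
        ...   | e ◅ _ = K-end (edge e)

        -- If `ab` is present, then `a` lies in `H` and is joined to `r`; the first edge of this
        -- connection leads from `r` to `a` or `b`.
        rooted-edge : T z → T x ⊎ T y
        rooted-edge tz with E? H r a | E? H r b
        ... | yes _ | _     = inj₁ tt
        ... | no _  | yes _ = inj₂ tt
        ... | no ¬x | no ¬y with E? H a b | tz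
        ...   | yes e | _ with conn c hr (end c e)
        ...     | ε = ⊥-elim (r≢a refl)
        ...     | f ◅ _ with in₃ (end c (symm c f))
        ...       | inj₁ refl        = ⊥-elim (no-loop {H} c f)
        ...       | inj₂ (inj₁ refl) = ⊥-elim (¬x f)
        ...       | inj₂ (inj₂ refl) = ⊥-elim (¬y f)

        shape : H ≈ K
        shape = (vertex , edge) ,
          ((λ { (inj₁ p) → proj₁ (opt-⊆ (E? H r a)) p ; (inj₂ (inj₁ p)) → proj₁ (opt-⊆ (E? H r b)) p
              ; (inj₂ (inj₂ p)) → proj₁ (opt-⊆ (E? H a b)) p }) ,
           (λ { (inj₁ p) → proj₂ (opt-⊆ (E? H r a)) p ; (inj₂ (inj₁ p)) → proj₂ (opt-⊆ (E? H r b)) p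
              ; (inj₂ (inj₂ p)) → proj₂ (opt-⊆ (E? H a b)) p }))

      cover : Cover (Within₃ G r a b) 7
      cover = (λ i → pattern-of (table i)) , find
        where
        find : ∀ {H} → Within₃ G r a b H → ∃ λ i → H ≈ pattern-of (table i)
        find {H} w with i , eq ← table-onto _ _ _ (Shape.rooted-edge {H} w) =
          i , subst (λ t → H ≈ pattern-of t) (sym eq) (Shape.shape {H} w)

-- Upper bound for two triangles joined by a path.

data Edge (N : ℕ) : ℕ → ℕ → Set where
  e01  : Edge N 0 1
  e02  : Edge N 0 2
  e12  : Edge N 1 2
  path : ∀ {a} → 2 ≤ a → suc a ≤ N → Edge N a (suc a)
  eN1  : Edge N N (1 + N)
  eN2  : Edge N N (2 + N)
  e1N2 : Edge N (1 + N) (2 + N)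

edge-view : ∀ N a b → T (c33ℕ (3 + N) a b) → Edge N a b
edge-view N a b t with Equivalence.to (T-∨ {(a ℕ.≡ᵇ 0) ∧ (b ℕ.≡ᵇ 1)}) t
... | inj₁ p with q , r ← Equivalence.to (T-∧ {a ℕ.≡ᵇ 0}) p
  with refl ← ≡ᵇ⇒≡ a _ q | refl ← ≡ᵇ⇒≡ b _ r = e01
... | inj₂ t₁ with Equivalence.to (T-∨ {(a ℕ.≡ᵇ 0) ∧ (b ℕ.≡ᵇ 2)}) t₁
... | inj₁ p with q , r ← Equivalence.to (T-∧ {a ℕ.≡ᵇ 0}) p
  with refl ← ≡ᵇ⇒≡ a _ q | refl ← ≡ᵇ⇒≡ b _ r = e02
... | inj₂ t₂ with Equivalence.to (T-∨ {(a ℕ.≡ᵇ 1) ∧ (b ℕ.≡ᵇ 2)}) t₂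
... | inj₁ p with q , r ← Equivalence.to (T-∧ {a ℕ.≡ᵇ 1}) p
  with refl ← ≡ᵇ⇒≡ a _ q | refl ← ≡ᵇ⇒≡ b _ r = e12
... | inj₂ t₃ with Equivalence.to (T-∨ {(2 ℕ.≤ᵇ a) ∧ (b ℕ.≡ᵇ suc a) ∧ (b ℕ.≤ᵇ N)}) t₃
... | inj₁ p with q , r ← Equivalence.to (T-∧ {2 ℕ.≤ᵇ a}) p
  with r , s ← Equivalence.to (T-∧ {b ℕ.≡ᵇ suc a}) r
  with refl ← ≡ᵇ⇒≡ b _ r = path (≤ᵇ⇒≤ 2 a q) (≤ᵇ⇒≤ _ N s)
... | inj₂ t₄ with Equivalence.to (T-∨ {(a ℕ.≡ᵇ N) ∧ (b ℕ.≡ᵇ 1 + N)}) t₄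
... | inj₁ p with q , r ← Equivalence.to (T-∧ {a ℕ.≡ᵇ N}) p
  with refl ← ≡ᵇ⇒≡ a _ q | refl ← ≡ᵇ⇒≡ b _ r = eN1
... | inj₂ t₅ with Equivalence.to (T-∨ {(a ℕ.≡ᵇ N) ∧ (b ℕ.≡ᵇ 2 + N)}) t₅
... | inj₁ p with q , r ← Equivalence.to (T-∧ {a ℕ.≡ᵇ N}) p
  with refl ← ≡ᵇ⇒≡ a _ q | refl ← ≡ᵇ⇒≡ b _ r = eN2
... | inj₂ p with q , r ← Equivalence.to (T-∧ {a ℕ.≡ᵇ 1 + N}) p
  with refl ← ≡ᵇ⇒≡ a _ q | refl ← ≡ᵇ⇒≡ b _ r = e1N2

edge-< : ∀ {N a b} → Edge N a b → a < b
edge-< e01        = s≤s z≤n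
edge-< e02        = s≤s z≤n
edge-< e12        = s≤s (s≤s z≤n)
edge-< (path _ _) = ≤-refl
edge-< eN1        = ≤-refl
edge-< eN2        = s≤s (n≤1+n _)
edge-< e1N2       = ≤-refl

-- Going down from a path vertex above 2 there is only one way, which makes it pendant among the
-- lower vertices.
edge-path : ∀ {N a b} → Edge N a b → 3 ≤ b → b ≤ N → suc a ≡ b
edge-path e01        (s≤s ()) _
edge-path e02        (s≤s (s≤s ())) _
edge-path e12        (s≤s (s≤s ())) _
edge-path (path _ _) _ _ = refl
edge-path eN1        _ _ = refl
edge-path eN2        _ p = ⊥-elim (<⇒≱ (s≤s (n≤1+n _)) p)
edge-path e1N2       _ _ = refl

-- This says that `N` is a cut vertex.
edge-side : ∀ {N a b} → 2 ≤ N → Edge N a b → b ≤ N ⊎ N ≤ a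
edge-side 2≤N e01        = inj₁ (<⇒≤ 2≤N)
edge-side 2≤N e02        = inj₁ 2≤N
edge-side 2≤N e12        = inj₁ 2≤N
edge-side 2≤N (path _ p) = inj₁ p
edge-side 2≤N eN1        = inj₂ ≤-refl
edge-side 2≤N eN2        = inj₂ ≤-refl
edge-side 2≤N e1N2       = inj₂ (n≤1+n _)

module C33Upper (l : ℕ) where

  -- `N` is the attaching vertex of the second triangle. For l = 0 it is vertex 2, shared by both
  -- triangles.
  N n : ℕ
  N = 2 + l
  n = 3 + N

  G : Graph n
  G = C33 n

  adj-view : ∀ u v → T (G u v) → Edge N (toℕ u) (toℕ v) ⊎ Edge N (toℕ v) (toℕ u)
  adj-view u v t with Equivalence.to (T-∨ {c33ℕ n (toℕ u) (toℕ v)}) t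
  ... | inj₁ p = inj₁ (edge-view N _ _ p)
  ... | inj₂ p = inj₂ (edge-view N _ _ p)

  irrefl : ∀ u → ¬ T (G u u)
  irrefl u t with adj-view u u t
  ... | inj₁ e = n≮n _ (edge-< e)
  ... | inj₂ e = n≮n _ (edge-< e)

  Low : ℕ → Sub n → Set
  Low j H = Conn G H × (∀ {v} → V H v → toℕ v ≤ j)

  Root : Fin n → Sub n → Set
  Root c H = Low (toℕ c) H × V H c

  low? : ∀ j (v : Fin n) → Dec (toℕ v ≤ j)
  low? j v = toℕ v ≤? j

  vx : ∀ j → j ≤ 2 + N → Fin n
  vx j j≤ = fromℕ< (s≤s j≤)

  vx-toℕ : ∀ j (j≤ : j ≤ 2 + N) → toℕ (vx j j≤) ≡ j
  vx-toℕ j j≤ = toℕ-fromℕ< (s≤s j≤)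

  -- A path vertex c is pendant among the vertices up to c.
  pendant-cover : ∀ {b c m} → toℕ c ≡ suc (toℕ b) → 2 ≤ toℕ b → toℕ c ≤ N →
    Cover (Root b) m → Cover (Root c) (1 + m)
  pendant-cover {b} {c} {m} c≡ 2≤b c≤N R =
    Cover-⊎ {Q = λ H → H ≈ pt c} {R = λ H → Root c H × E H c b} split (Cover-one (pt c) (λ x → x))
      (subst (Cover _) (*-identityʳ m)
        (Cover-∪ {Q = Root b} {R = λ K → K ≈ ed c b} cut R (Cover-one (ed c b) (λ x → x))))
    where
    neighbour : ∀ {x} → T (G c x) → toℕ x ≤ toℕ c → x ≡ b
    neighbour {x} t x≤c with adj-view c x t
    ... | inj₁ e = ⊥-elim (<⇒≱ (edge-< e) x≤c)
    ... | inj₂ e = toℕ-injective (suc-injective (trans (edge-path e (subst (3 ≤_) (sym c≡) (s≤s 2≤b)) c≤N) c≡))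
    split : ∀ {H} → Root c H → (H ≈ pt c) ⊎ (Root c H × E H c b)
    split {H} R@((C , lo) , hc) with E? H c b
    ... | yes e = inj₂ (R , e)
    ... | no ¬e = inj₁ (isolated {G = G} {H} C hc (λ e →
            ¬e (subst (E H c) (neighbour (adj C e) (lo (end C (symm C e)))) e)))
    cut : ∀ {H} → Root c H × E H c b → Σ (Sub n) λ K → Σ (Sub n) λ L → Root b K × L ≈ ed c b × H ≈ K ∪ L
    cut {H} (((C , lo) , hc) , e) = K , ed c b ,
      ((restrict-conn {G = G} {H} (low? (toℕ b)) C (end C (symm C e)) ≤-refl boundary , proj₂) , end C (symm C e) , ≤-refl) ,
      (((λ x → x) , (λ x → x)) , ((λ x → x) , (λ x → x))) ,
      ((fv , fe) , ((λ { (inj₁ (h , _)) → h ; (inj₂ (inj₁ refl)) → hc ; (inj₂ (inj₂ refl)) → end C (symm C e) }) ,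
                    (λ { (inj₁ (h , _)) → h ; (inj₂ (inj₁ (refl , refl))) → e ; (inj₂ (inj₂ (refl , refl))) → symm C e })))
      where
      K : Sub n
      K = restrict (low? (toℕ b)) H
      high : ∀ {v} → V H v → ¬ toℕ v ≤ toℕ b → v ≡ c
      high hv ¬l = toℕ-injective (≤-antisym (lo hv) (subst (_≤ _) (sym c≡) (≰⇒> ¬l)))
      boundary : ∀ {u v} → E H u v → toℕ u ≤ toℕ b → ¬ toℕ v ≤ toℕ b → u ≡ b
      boundary f _ ¬l with refl ← high (end C (symm C f)) ¬l = neighbour (adj C (symm C f)) (lo (end C f))
      fv : ∀ {v} → V H v → V (K ∪ ed c b) v
      fv {v} hv with low? (toℕ b) v
      ... | yes p = inj₁ (hv , p)
      ... | no ¬p = inj₂ (inj₁ (high hv ¬p))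
      fe : ∀ {u v} → E H u v → E (K ∪ ed c b) u v
      fe {u} {v} f with low? (toℕ b) u | low? (toℕ b) v
      ... | yes p | yes q = inj₁ (f , p , q)
      ... | no ¬p | _ with refl ← high (end C f) ¬p = inj₂ (inj₁ (refl , neighbour (adj C f) (lo (end C (symm C f)))))
      ... | yes p | no ¬q with refl ← high (end C (symm C f)) ¬q = inj₂ (inj₂ (boundary f p ¬q , refl))

  v₀ v₁ v₂ : Fin n
  v₀ = zero
  v₁ = suc zero
  v₂ = suc (suc zero)

  -- The first triangle offers 7 patterns at vertex 2. Each further path vertex adds one subgraph,
  -- the point itself, because all others continue through its predecessor.
  rooted-cover : ∀ i (c : Fin n) → toℕ c ≡ 2 + i → 2 + i ≤ N → Cover (Root c) (i + 7)
  rooted-cover zero c eq _ with refl ← toℕ-injective {i = c} {v₂} eq =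
    Cover-⊆ (λ ((C , lo) , h) → C , h , λ hv → three _ (lo hv)) (Triangle.cover irrefl v₂ v₀ v₁ (λ ()))
    where
    three : ∀ (v : Fin n) → toℕ v ≤ 2 → v ≡ v₂ ⊎ v ≡ v₀ ⊎ v ≡ v₁
    three zero                _ = inj₂ (inj₁ refl)
    three (suc zero)          _ = inj₂ (inj₂ refl)
    three (suc (suc zero))    _ = inj₁ refl
    three (suc (suc (suc _))) (s≤s (s≤s ()))
  rooted-cover (suc i) c eq le =
    pendant-cover {b} {c} (trans eq (cong suc (sym b≡))) (subst (2 ≤_) (sym b≡) (s≤s (s≤s z≤n)))
      (subst (_≤ N) (sym eq) le) (rooted-cover i b b≡ (<⇒≤ le))
    where
    b≤ : 2 + i ≤ 2 + N
    b≤ = ≤-trans (<⇒≤ le) (m≤n+m N 2)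
    b : Fin n
    b = vx (2 + i) b≤
    b≡ : toℕ b ≡ 2 + i
    b≡ = vx-toℕ (2 + i) b≤

  -- The value 3 counts the two points and the edge on {0, 1}; each summand `i + 7` comes from the
  -- subgraphs whose highest vertex is 2 + i.
  lows : ℕ → ℕ
  lows zero    = 3
  lows (suc i) = (i + 7) + lows i

  low-cover : ∀ i → 1 + i ≤ N → Cover (Low (1 + i)) (lows i)
  low-cover zero _ = Cover-⊆ (λ (C , lo) → C , λ hv → two _ (lo hv)) (pair-cover irrefl v₀ v₁)
    where
    two : ∀ (v : Fin n) → toℕ v ≤ 1 → v ≡ v₀ ⊎ v ≡ v₁
    two zero          _ = inj₁ refl
    two (suc zero)    _ = inj₂ refl
    two (suc (suc _)) (s≤s ())
  low-cover (suc i) le = Cover-⊎ {Q = Root c} {R = Low (1 + i)} split (rooted-cover i c c≡ le) (low-cover i (<⇒≤ le))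
    where
    c≤ : 2 + i ≤ 2 + N
    c≤ = ≤-trans le (m≤n+m N 2)
    c : Fin n
    c = vx (2 + i) c≤
    c≡ : toℕ c ≡ 2 + i
    c≡ = vx-toℕ (2 + i) c≤
    split : ∀ {H} → Low (2 + i) H → Root c H ⊎ Low (1 + i) H
    split {H} (C , lo) with V? H c
    ... | yes hc = inj₁ ((C , λ {v} hv → subst (toℕ v ≤_) (sym c≡) (lo hv)) , hc)
    ... | no ¬hc = inj₂ (C , λ {v} hv → ≤-pred (≤∧≢⇒< (lo hv)
            (λ eq → ¬hc (subst (V H) (toℕ-injective (trans eq (sym c≡))) hv))))

  r p q : Fin n
  r = vx N (m≤n+m N 2)
  p = vx (1 + N) (n≤1+n _)
  q = vx (2 + N) ≤-refl

  r≡ : toℕ r ≡ N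
  r≡ = vx-toℕ N (m≤n+m N 2)
  p≡ : toℕ p ≡ 1 + N
  p≡ = vx-toℕ (1 + N) (n≤1+n _)
  q≡ : toℕ q ≡ 2 + N
  q≡ = vx-toℕ (2 + N) ≤-refl

  2≤N : 2 ≤ N
  2≤N = s≤s (s≤s z≤n)

  top-two : ∀ (v : Fin n) → N < toℕ v → v ≡ p ⊎ v ≡ q
  top-two v N<v with m≤n⇒m<n∨m≡n N<v
  ... | inj₂ eq = inj₁ (toℕ-injective (trans (sym eq) (sym p≡)))
  ... | inj₁ lt = inj₂ (toℕ-injective (trans (≤-antisym (≤-pred (toℕ<n v)) lt) (sym q≡)))

  side : ∀ {u v} → T (G u v) → (toℕ u ≤ N × toℕ v ≤ N) ⊎ (N ≤ toℕ u × N ≤ toℕ v)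
  side {u} {v} t with adj-view u v t
  ... | inj₁ e with edge-side 2≤N e
  ...   | inj₁ v≤ = inj₁ (≤-trans (<⇒≤ (edge-< e)) v≤ , v≤)
  ...   | inj₂ ≤u = inj₂ (≤u , ≤-trans ≤u (<⇒≤ (edge-< e)))
  side {u} {v} t | inj₂ e with edge-side 2≤N e
  ...   | inj₁ u≤ = inj₁ (u≤ , ≤-trans (<⇒≤ (edge-< e)) u≤)
  ...   | inj₂ ≤v = inj₂ (≤-trans ≤v (<⇒≤ (edge-< e)) , ≤v)

  at-r : ∀ {u} → toℕ u ≤ N → N ≤ toℕ u → u ≡ r
  at-r u≤ ≤u = toℕ-injective (trans (≤-antisym u≤ ≤u) (sym r≡))

  -- At the cut vertex `r` a subgraph falls into a lower part rooted at `r` and one of the 7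
  -- patterns of the second triangle.
  through-r : Cover (λ H → Conn G H × V H r) ((l + 7) * 7)
  through-r = Cover-∪ {Q = Root r} {R = Within₃ G r p q} cut (rooted-cover l r r≡ ≤-refl)
    (Triangle.cover irrefl r p q (λ eq → n≮n N (≤-reflexive (sym (trans (sym r≡) (trans (cong toℕ eq) p≡))))))
    where
    high? : ∀ (v : Fin n) → Dec (N ≤ toℕ v)
    high? v = N ≤? toℕ v
    cut : ∀ {H} → Conn G H × V H r → Σ (Sub n) λ K → Σ (Sub n) λ L → Root r K × Within₃ G r p q L × H ≈ K ∪ L
    cut {H} (C , hr) = restrict (low? N) H , restrict high? H ,
      ((restrict-conn {G = G} {H} (low? N) C hr (≤-reflexive r≡) below , λ {v} (_ , v≤) → subst (toℕ v ≤_) (sym r≡) v≤) ,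
        hr , ≤-reflexive r≡) ,
      (restrict-conn {G = G} {H} high? C hr (≤-reflexive (sym r≡)) above , (hr , ≤-reflexive (sym r≡)) , λ (_ , ≤v) → top ≤v) ,
      restrict-∪ {H = H} (low? N) high? (λ {v} _ → ≤-total (toℕ v) N) (λ e → side (adj C e))
      where
      below : ∀ {u v} → E H u v → toℕ u ≤ N → ¬ toℕ v ≤ N → u ≡ r
      below e u≤ v≰ with side (adj C e)
      ... | inj₁ (_ , v≤) = ⊥-elim (v≰ v≤)
      ... | inj₂ (≤u , _) = at-r u≤ ≤u
      above : ∀ {u v} → E H u v → N ≤ toℕ u → ¬ N ≤ toℕ v → u ≡ r
      above e ≤u ≰v with side (adj C e)
      ... | inj₁ (u≤ , _) = at-r u≤ ≤u
      ... | inj₂ (_ , ≤v) = ⊥-elim (≰v ≤v)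
      top : ∀ {v} → N ≤ toℕ v → v ≡ r ⊎ v ≡ p ⊎ v ≡ q
      top {v} ≤v with m≤n⇒m<n∨m≡n ≤v
      ... | inj₁ lt = inj₂ (top-two v lt)
      ... | inj₂ eq = inj₁ (toℕ-injective (trans (sym eq) (sym r≡)))

  -- Without the cut vertex a connected subgraph stays on one side: below `N`, or on the edge `pq`
  -- with its 3 subgraphs.
  avoiding-r : Cover (λ H → Conn G H × ¬ V H r) (lows l + 3)
  avoiding-r = Cover-⊎ {Q = Low (1 + l)} {R = Within₂ G p q} split (low-cover l (n≤1+n _)) (pair-cover irrefl p q)
    where
    split : ∀ {H} → Conn G H × ¬ V H r → Low (1 + l) H ⊎ Within₂ G p q H
    split {H} (C , ¬hr) with any? (λ v → V? H v ×-dec low? N v)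
    ... | no none = inj₂ (C , λ {v} hv → top-two v (≰⇒> (λ v≤ → none (v , hv , v≤))))
    ... | yes (v , hv , v≤) = inj₁ (C , λ hu → ≤-pred (≤∧≢⇒< (stay v≤ (conn C hv hu))
            (λ eq → ¬hr (subst (V H) (toℕ-injective (trans eq (sym r≡))) hu))))
      where
      stay : ∀ {u w} → toℕ u ≤ N → Star (E H) u w → toℕ w ≤ N
      stay u≤ ε = u≤
      stay u≤ (e ◅ s) with side (adj C e)
      ... | inj₁ (_ , x≤) = stay x≤ s
      ... | inj₂ (≤u , _) = ⊥-elim (¬hr (subst (V H) (at-r u≤ ≤u) (end C e)))

  lows-tri : ∀ i → (i + 7) * 7 + (lows i + 3) ≡ tri (5 + i) + 8 * (5 + i)
  lows-tri zero    = refl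
  lows-tri (suc i) = trans (re₁ i (lows i)) (trans (cong (_+ (i + 14)) (lows-tri i)) (re₂ i (tri (5 + i))))
    where
    re₁ : ∀ i s → (suc i + 7) * 7 + ((i + 7) + s + 3) ≡ (i + 7) * 7 + (s + 3) + (i + 14)
    re₁ = solve-∀
    re₂ : ∀ i t → t + 8 * (5 + i) + (i + 14) ≡ (6 + i) + t + 8 * (6 + i)
    re₂ = solve-∀

  c33-cover : Cover (Conn G) (tri n + 8 * n)
  c33-cover = subst (Cover (Conn G)) (lows-tri l)
    (Cover-⊎ {Q = λ H → Conn G H × V H r} {R = λ H → Conn G H × ¬ V H r} split through-r avoiding-r)
    where
    split : ∀ {H} → Conn G H → (Conn G H × V H r) ⊎ (Conn G H × ¬ V H r)
    split {H} C with V? H r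
    ... | yes h = inj₁ (C , h)
    ... | no ¬h = inj₂ (C , ¬h)

-- Comparison of the two bounds, and the theorem.

tri-≤-square : ∀ {n} → 17 ≤ n → tri n + 8 * n ≤ n * n + 1
tri-≤-square {n} 17≤n = *-cancelˡ-≤ 2 (begin
  2 * (tri n + 8 * n)        ≡⟨ re₁ (tri n) n ⟩
  (tri n + tri n) + 16 * n   ≡⟨ cong (_+ 16 * n) (tri-double n) ⟩
  n * suc n + 16 * n         ≡⟨ re₂ n ⟩
  n * n + 17 * n             ≤⟨ +-monoʳ-≤ (n * n) (*-monoˡ-≤ n 17≤n) ⟩
  n * n + n * n              ≤⟨ m≤m+n (n * n + n * n) 2 ⟩
  n * n + n * n + 2          ≡⟨ re₃ n ⟩
  2 * (n * n + 1)            ∎)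
  where
  open ≤-Reasoning
  re₁ : ∀ t n → 2 * (t + 8 * n) ≡ (t + t) + 16 * n
  re₁ = solve-∀
  re₂ : ∀ n → n * suc n + 16 * n ≡ n * n + 17 * n
  re₂ = solve-∀
  re₃ : ∀ n → n * n + n * n + 2 ≡ 2 * (n * n + 1)
  re₃ = solve-∀

square-≤-tri : ∀ {n} → 5 ≤ n → n ≤ 16 → n * n + 1 ≤ tri n + 8 * n
square-≤-tri 5≤n n≤16 = subst (λ i → i * i + 1 ≤ tri i + 8 * i) (toℕ-fromℕ< (s≤s n≤16))
  (check (fromℕ< (s≤s n≤16)) (subst (5 ≤_) (sym (toℕ-fromℕ< (s≤s n≤16))) 5≤n))
  where
  check : ∀ (i : Fin 17) → 5 ≤ toℕ i → toℕ i * toℕ i + 1 ≤ tri (toℕ i) + 8 * toℕ i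
  check = toWitness {a? = all? λ i → (5 ≤? toℕ i) →-dec (toℕ i * toℕ i + 1 ≤? tri (toℕ i) + 8 * toℕ i)} tt

half-tri : ∀ n → (n * n + 17 * n) / 2 ≡ tri n + 8 * n
half-tri n = trans (cong (_/ 2) (trans (re₁ n) (trans (cong (_+ 16 * n) (sym (tri-double n))) (re₂ (tri n) n))))
  (m*n/n≡m (tri n + 8 * n) 2)
  where
  re₁ : ∀ n → n * n + 17 * n ≡ n * suc n + 16 * n
  re₁ = solve-∀
  re₂ : ∀ t n → (t + t) + 16 * n ≡ (t + 8 * n) * 2
  re₂ = solve-∀

cycle-index : ∀ {n m} → 5 ≤ n → CoreIndex (Cycle n) m → m ≤ n * n + 1
cycle-index {suc n} _ c = index-≤-Cover c (CycleUpper.cycle-cover n)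

c33-index : ∀ {n m} → 5 ≤ n → CoreIndex (C33 n) m → m ≤ tri n + 8 * n
c33-index 5≤n c with l , refl ← m≤n⇒∃[o]m+o≡n 5≤n = index-≤-Cover c (C33Upper.c33-cover l)

theorem5p16 : (n : ℕ) (G : Graph n) → 5 ≤ n → IsSimple G → Connected G → NoPendant G →
    ∀ (k : ℕ) → CoreIndex G k →
    (n ≤ 16 → ∀ (m : ℕ) → CoreIndex (Cycle n) m → m ≤ k)
    × (16 < n → ∀ (m : ℕ) → CoreIndex (C33 n) m → m ≤ k)
    × ((n * n + 1) ⊓ ((n * n + 17 * n) / 2) ≤ k)
theorem5p16 n G 5≤n simple connected no-pendant k index =
  (λ n≤16 m c → ≤-trans (cycle-index 5≤n c) ([ (λ b → b) , ≤-trans (square-≤-tri 5≤n n≤16) ]′ bound)) ,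
  (λ 16<n m c → ≤-trans (c33-index 5≤n c) ([ ≤-trans (tri-≤-square 16<n) , (λ b → b) ]′ bound)) ,
  [ ≤-trans (m⊓n≤m _ _) , (λ b → ≤-trans (m⊓n≤n (n * n + 1) _) (≤-trans (≤-reflexive (half-tri n)) b)) ]′ bound
  where
  bound : (n * n + 1 ≤ k) ⊎ (tri n + 8 * n ≤ k)
  bound = Ears.lower-bound simple connected no-pendant (Fam-≤-index index) 5≤n
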